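{- Suppose that $R_1,R_2$ are two simply-connected regions in the plane, with mandated partial height functions $f_1,f_2$ along their boundaries (that is, $f_i$ is defined on the set of vertices on the boundary of $R_i$) that agree modulo $4$, such that every vertex $v_1$ on the boundary of $R_1$ is within sup-norm distance $\Delta_1$ of some vertex $v_2$ on the boundary of $R_2$, and vice versa, and such that whenever vertices $v_1$ and $v_2$ on the respective boundaries are within sup-norm distance $\Delta_1$ of each other, the heights $f_1(v_1)$ and $f_2(v_2)$ are within $\Delta_2$ of each other (i.e. $|f_1(v_1)-f_2(v_2)|\le\Delta_2$). Then, for any vertex $v$ in $R_1\cap R_2$, the expected value of $H(v)$ under $\mu_{f_1}$ and the expected value of $H(v)$ under $\mu_{f_2}$ differ by at most $2\Delta_1+\Delta_2+1$.
   Context: A region is a finite union of unit squares of the square lattice that can be tiled by dominos. The lattice squares are colored black and white in a fixed checkerboard coloring of the plane. A height function on a simply-connected region $R$ is an integer-valued function $h$ on the vertices of the lattice squares of $R$ such that, for adjacent vertices $u,v$ (joined by an edge of a lattice square of $R$): if the edge $uv$ is part of the boundary of $R$ then $|h(u)-h(v)|=1$, and if the directed edge from $u$ to $v$ has a black square on its left then $h(v)$ is either $h(u)+1$ or $h(u)-3$. Height functions correspond to domino tilings: the dominos are those bisected by the edges $uv$ with $|h(u)-h(v)|=3$; every tiling arises from a height function unique up to an additive constant, and once the height at one boundary vertex is fixed, all height functions agree on the boundary. A partial height function is an integer-valued function satisfying the constraint $f(v)-f(u)\in\{1,-3\}$ (for the directed edge from $u$ to $v$ having a black square on its left) on a connected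 subset of the vertices of $R$ containing all boundary vertices; it is complete if it is defined on all vertices of $R$, and a complete height function extends $f$ if it agrees with $f$ where $f$ is defined. The mandated partial height function along the boundary of $R_i$ is the common boundary restriction of the height functions of the tilings of $R_i$ (for some choice of additive constant). $\mu_{f}$ denotes the uniform distribution on the set of complete height functions extending $f$, and $H$ denotes a random complete height function. Two partial height functions defined on different sets agree modulo $4$ if all height functions extending them agree modulo $4$ (at the vertices where both are defined; the values of height functions modulo $4$ are determined on the plane's lattice by the value at a single point). -}

module Defs where

open import Data.Nat as ℕ using (ℕ; zero; suc; z≤n; s≤s)
import Data.Nat.Properties as ℕ
import Data.Nat.Divisibility as ℕ
open import Data.Integer as ℤ using (ℤ; +_; -[1+_]; ∣_∣)
import Data.Integer.Properties as ℤ
open import Data.Integer.Divisibility using (_∣_)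
open import Data.Rational as ℚ using (ℚ; 0ℚ)
open import Data.Product using (Σ; _×_; _,_; ∃; proj₁; proj₂)
open import Data.Product.Properties using (≡-dec)
open import Data.Sum using (_⊎_; inj₁; inj₂; [_,_]′; swap)
open import Data.Empty using (⊥-elim)
open import Data.List using
  (List; []; _∷_; _++_; map; concat; concatMap; filter; foldr; foldl; length; upTo; deduplicate)
open import Data.List.Relation.Unary.All as All using (All; []; _∷_)
import Data.List.Relation.Unary.All.Properties as All
open import Data.List.Relation.Unary.Any using (here; there)
open import Data.List.Relation.Unary.AllPairs as AllPairs using (AllPairs; []; _∷_)
import Data.List.Relation.Unary.AllPairs.Properties as AllPairs
open import Data.List.Relation.Unary.Unique.Propositional using (Unique)
import Data.List.Relation.Unary.Unique.Propositional.Properties as Unique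
open import Data.List.Membership.Propositional using (_∈_; _∉_)
open import Data.List.Membership.Propositional.Properties
open import Function using (_∘_; _⇔_; mk⇔)
open import Relation.Nullary using (¬_; Dec; yes; no)
open import Relation.Nullary.Decidable as Dec using (_×-dec_; _⊎-dec_; _→-dec_; ¬?; map′)
open import Relation.Binary.PropositionalEquality

-- A unit square is named by its lower-left corner.
Vertex Square : Set
Vertex = ℤ × ℤ
Square = ℤ × ℤ

Black : Square → Set
Black (x , y) = + 2 ∣ x ℤ.+ y

data Dir : Set where
  E N W S : Dir

-- Counterclockwise quarter turn.
turn : Dir → Dir
turn E = N
turn N = W
turn W = S
turn S = E

opp : Dir → Dir
opp d = turn (turn d)

step : Vertex → Dir → Vertex
step (x , y) E = ℤ.suc x , y
step (x , y) N = x , ℤ.suc y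
step (x , y) W = ℤ.pred x , y
step (x , y) S = x , ℤ.pred y

-- The squares on either side of the directed edge from u to step u d.  As d
-- varies, left u d runs over the four squares having u as a corner.
left right : Vertex → Dir → Square
left (x , y) E = x , y
left (x , y) N = ℤ.pred x , y
left (x , y) W = ℤ.pred x , ℤ.pred y
left (x , y) S = x , ℤ.pred y
right u d = left u (turn (opp d))

supDist : Vertex → Vertex → ℕ
supDist (x , y) (x′ , y′) = ∣ x ℤ.- x′ ∣ ℕ.⊔ ∣ y ℤ.- y′ ∣

data Domino : Set where
  hor ver : Square → Domino

-- The square s together with its right, resp. upper, neighbour.
cells : Domino → List Square
cells (hor s) = s ∷ step s E ∷ []
cells (ver s) = s ∷ step s N ∷ []

-- An edge is given by its base point and direction.
bisector : Domino → Vertex × Dir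
bisector (hor s) = step s E , N
bisector (ver s) = step s N , E

record IsTiling (R : List Square) (T : List Domino) : Set where
  field
    disjoint : Unique (concatMap cells T)
    covers   : ∀ s → s ∈ concatMap cells T ⇔ s ∈ R

-- Only membership in `squares` matters: repetitions are harmless.
record Region : Set where
  field
    squares  : List Square
    tileable : ∃ λ T → IsTiling squares T

open Region public

module _ (R : Region) where

  IsVertex : Vertex → Set
  IsVertex v = ∃ λ d → left v d ∈ squares R

  IsEdge IsBoundaryEdge : Vertex → Dir → Set
  IsEdge u d = left u d ∈ squares R ⊎ right u d ∈ squares R
  IsBoundaryEdge u d = (left u d ∈ squares R × right u d ∉ squares R)
                     ⊎ (left u d ∉ squares R × right u d ∈ squares R)

  OnBoundary : Vertex → Set
  OnBoundary v = ∃ λ d → IsBoundaryEdge v d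

-- A region is the closed union of its squares, a two-dimensional cell complex
-- whose fundamental group is its edge-path group.  An edge path is given by its
-- starting vertex and the list of its directions.

end : Vertex → List Dir → Vertex
end = foldl step

module _ (R : Region) where

  data IsPath : Vertex → List Dir → Set where
    []  : ∀ {u} → IsPath u []
    _∷_ : ∀ {u d p} → IsEdge R u d → IsPath (step u d) p → IsPath u (d ∷ p)

  -- Homotopy of edge paths starting at u: insert or delete a backtracking along
  -- an edge of R, or a counterclockwise circuit around a square of R.
  data Homotopic (u : Vertex) : List Dir → List Dir → Set where
    reflexive  : ∀ {p} → Homotopic u p p
    symmetric  : ∀ {p q} → Homotopic u p q → Homotopic u q p
    transitive : ∀ {p q r} → Homotopic u p q → Homotopic u q r → Homotopic u p r
    backtrack  : ∀ p d q → IsEdge R (end u p) d →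
                 Homotopic u (p ++ d ∷ opp d ∷ q) (p ++ q)
    circuit    : ∀ p d q → left (end u p) d ∈ squares R →
                 Homotopic u (p ++ d ∷ turn d ∷ opp d ∷ turn (opp d) ∷ q) (p ++ q)

  record SimplyConnected : Set where
    field
      connected    : ∀ u v → IsVertex R u → IsVertex R v →
                     ∃ λ p → IsPath u p × end u p ≡ v
      contractible : ∀ u p → IsVertex R u → IsPath u p → end u p ≡ u →
                     Homotopic u p []

-- Functions on the vertices of R, or on its boundary vertices, are represented
-- by functions on the whole lattice whose other values are ignored.
Heights : Set
Heights = Vertex → ℤ

module _ (R : Region) where

  infix 4 _≈_
  _≈_ : Heights → Heights → Set
  h ≈ h′ = ∀ v → IsVertex R v → h v ≡ h′ v

  record IsHeight (h : Heights) : Set where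
    field
      boundary : ∀ u d → IsBoundaryEdge R u d → ∣ h (step u d) ℤ.- h u ∣ ≡ 1
      black    : ∀ u d → IsEdge R u d → Black (left u d) →
                 h (step u d) ≡ h u ℤ.+ + 1 ⊎ h (step u d) ≡ h u ℤ.- + 3

  record IsHeightOf (T : List Domino) (h : Heights) : Set where
    field
      isHeight : IsHeight h
      bisected : ∀ D → let (u , d) = bisector D in
                 D ∈ T ⇔ (IsEdge R u d × ∣ h (step u d) ℤ.- h u ∣ ≡ 3)

  AgreesOnBoundary : Heights → Heights → Set
  AgreesOnBoundary f h = ∀ v → OnBoundary R v → h v ≡ f v

  -- f is the common boundary restriction of the height functions of the tilings,
  -- each of these being normalised by a suitable additive constant.
  Mandated : Heights → Set
  Mandated f = ∀ T → IsTiling (squares R) T →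
               ∃ λ h → IsHeightOf T h × AgreesOnBoundary f h

  record Extends (f h : Heights) : Set where
    field
      isHeight : IsHeight h
      agrees   : AgreesOnBoundary f h

AgreeMod4 : (R₁ R₂ : Region) → Heights → Heights → Set
AgreeMod4 R₁ R₂ f₁ f₂ = ∀ h₁ h₂ → Extends R₁ f₁ h₁ → Extends R₂ f₂ h₂ →
  ∀ v → IsVertex R₁ v → IsVertex R₂ v → + 4 ∣ h₁ v ℤ.- h₂ v

-- Each complete height function extending f occurs exactly once, up to its
-- irrelevant values away from R.
record Enumeration (R : Region) (f : Heights) : Set where
  field
    list     : List Heights
    sound    : All (Extends R f) list
    complete : ∀ h → Extends R f h → ∃ λ g → g ∈ list × _≈_ R g h
    distinct : AllPairs (λ g h → ¬ _≈_ R g h) list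

Distribution : Set → Set
Distribution A = List (A × ℚ)

-- On the empty list, where there is no uniform distribution, this returns [].
uniform : {A : Set} → List A → Distribution A
uniform []          = []
uniform xs@(_ ∷ ys) = map (_, + 1 ℚ./ suc (length ys)) xs

𝔼 : {A : Set} → Distribution A → (A → ℚ) → ℚ
𝔼 μ X = foldr (λ (a , p) s → p ℚ.* X a ℚ.+ s) 0ℚ μ

-- Construction of the enumeration: an extension of f is bounded on the vertices
-- of R by a constant depending only on R and f, so it suffices to filter all
-- bounded assignments of heights to the vertices.

_≟_ : (u v : Vertex) → Dec (u ≡ v)
_≟_ = ≡-dec ℤ._≟_ ℤ._≟_

open import Data.List.Membership.DecPropositional _≟_ using (_∈?_)
import Data.List.Relation.Unary.Unique.DecPropositional.Properties _≟_ as UniqueDec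

dirs : List Dir
dirs = E ∷ N ∷ W ∷ S ∷ []

∈-dirs : ∀ d → d ∈ dirs
∈-dirs E = here refl
∈-dirs N = there (here refl)
∈-dirs W = there (there (here refl))
∈-dirs S = there (there (there (here refl)))

left-step-turn : ∀ u d → left (step u d) (turn d) ≡ left u d
left-step-turn (x , y) E = cong (_, y) (ℤ.pred-suc x)
left-step-turn (x , y) N = cong (ℤ.pred x ,_) (ℤ.pred-suc y)
left-step-turn (x , y) W = refl
left-step-turn (x , y) S = refl

left-step-opp : ∀ u d → left (step u d) (opp d) ≡ right u d
left-step-opp (x , y) E = cong (_, ℤ.pred y) (ℤ.pred-suc x)
left-step-opp (x , y) N = cong (x ,_) (ℤ.pred-suc y)
left-step-opp (x , y) W = refl
left-step-opp (x , y) S = refl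

corners : Square → List Vertex
corners s = s ∷ step s E ∷ step s N ∷ step (step s E) N ∷ []

∈-corners : ∀ v d → v ∈ corners (left v d)
∈-corners (x , y) E = here refl
∈-corners (x , y) N = there (here (cong (_, y) (sym (ℤ.suc-pred x))))
∈-corners (x , y) W =
  there (there (there (here (sym (cong₂ _,_ (ℤ.suc-pred x) (ℤ.suc-pred y))))))
∈-corners (x , y) S = there (there (here (cong (x ,_) (sym (ℤ.suc-pred y)))))

corners-∈ : ∀ v s → v ∈ corners s → ∃ λ d → left v d ≡ s
corners-∈ v s       (here refl)                         = E , refl
corners-∈ v (x , y) (there (here refl))                 = N , cong (_, y) (ℤ.pred-suc x)
corners-∈ v (x , y) (there (there (here refl)))         = S , cong (x ,_) (ℤ.pred-suc y)
corners-∈ v (x , y) (there (there (there (here refl)))) =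
  W , cong₂ _,_ (ℤ.pred-suc x) (ℤ.pred-suc y)

even-or-suc-even : ∀ z → (+ 2 ∣ z) ⊎ (+ 2 ∣ ℤ.suc z)
even-or-suc-even = λ where
    (+ n)          → go n
    -[1+ zero ]    → inj₂ (2 ℕ.∣0)
    -[1+ suc n ]   → swap (go (suc n))
  where
  go : ∀ n → 2 ℕ.∣ n ⊎ 2 ℕ.∣ suc n
  go zero    = inj₁ (2 ℕ.∣0)
  go (suc n) with go n
  ... | inj₁ p = inj₂ (ℕ.∣m∣n⇒∣m+n ℕ.∣-refl p)
  ... | inj₂ p = inj₁ p

left-or-right-black : ∀ v → Black (left v W) ⊎ Black (right v W)
left-or-right-black (x , y) with even-or-suc-even (ℤ.pred x ℤ.+ ℤ.pred y)
... | inj₁ p = inj₁ p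
... | inj₂ p = inj₂ (subst (+ 2 ∣_) eq p)
  where
  eq : ℤ.suc (ℤ.pred x ℤ.+ ℤ.pred y) ≡ ℤ.pred x ℤ.+ y
  eq = begin
    ℤ.suc (ℤ.pred x ℤ.+ ℤ.pred y)   ≡⟨ cong ℤ.suc (ℤ.+-comm (ℤ.pred x) (ℤ.pred y)) ⟩
    ℤ.suc (ℤ.pred y ℤ.+ ℤ.pred x)   ≡⟨ ℤ.+-assoc (+ 1) (ℤ.pred y) (ℤ.pred x) ⟨
    ℤ.suc (ℤ.pred y) ℤ.+ ℤ.pred x   ≡⟨ cong (ℤ._+ ℤ.pred x) (ℤ.suc-pred y) ⟩
    y ℤ.+ ℤ.pred x                  ≡⟨ ℤ.+-comm y (ℤ.pred x) ⟩
    ℤ.pred x ℤ.+ y                  ∎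
    where open ≡-Reasoning

∣i∣≤∣i+j∣+∣j∣ : ∀ i j → ∣ i ∣ ℕ.≤ ∣ i ℤ.+ j ∣ ℕ.+ ∣ j ∣
∣i∣≤∣i+j∣+∣j∣ i j = subst (λ k → ∣ k ∣ ℕ.≤ ∣ i ℤ.+ j ∣ ℕ.+ ∣ j ∣) eq (ℤ.∣i-j∣≤∣i∣+∣j∣ (i ℤ.+ j) j)
  where
  eq : i ℤ.+ j ℤ.- j ≡ i
  eq = trans (ℤ.+-assoc i j (ℤ.- j))
       (trans (cong (λ k → i ℤ.+ k) (ℤ.+-inverseʳ j)) (ℤ.+-identityʳ i))

maximum : (Vertex → ℕ) → List Vertex → ℕ
maximum φ = foldr (λ v m → φ v ℕ.⊔ m) 0

≤-maximum : ∀ φ vs {v} → v ∈ vs → φ v ℕ.≤ maximum φ vs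
≤-maximum φ (v ∷ vs) (here refl) = ℕ.m≤m⊔n (φ v) _
≤-maximum φ (v ∷ vs) (there v∈)  = ℕ.≤-trans (≤-maximum φ vs v∈) (ℕ.m≤n⊔m (φ v) _)

ball : ℕ → List ℤ
ball B = map +_ (upTo (suc B)) ++ map -[1+_] (upTo B)

∈-ball : ∀ {B} z → ∣ z ∣ ℕ.≤ B → z ∈ ball B
∈-ball {B} (+ n)    n≤B = ∈-++⁺ˡ (∈-map⁺ +_ (∈-upTo⁺ (s≤s n≤B)))
∈-ball {B} -[1+ n ] n<B = ∈-++⁺ʳ (map +_ (upTo (suc B))) (∈-map⁺ -[1+_] (∈-upTo⁺ n<B))

ball-unique : ∀ B → Unique (ball B)
ball-unique B = Unique.++⁺ (Unique.map⁺ ℤ.+-injective (Unique.upTo⁺ (suc B)))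
                           (Unique.map⁺ ℤ.-[1+-injective (Unique.upTo⁺ B))
                           disjoint
  where
  disjoint : ∀ {z} → ¬ (z ∈ map +_ (upTo (suc B)) × z ∈ map -[1+_] (upTo B))
  disjoint (p , q) with ∈-map⁻ +_ p | ∈-map⁻ -[1+_] q
  ... | _ , _ , refl | _ , _ , ()

update : Vertex → ℤ → Heights → Heights
update v z h u with u ≟ v
... | yes _ = z
... | no  _ = h u

update-same : ∀ v z h → update v z h v ≡ z
update-same v z h with v ≟ v
... | yes _ = refl
... | no v≢v = ⊥-elim (v≢v refl)

update-other : ∀ {u v} z h → u ≢ v → update v z h u ≡ h u
update-other {u} {v} z h u≢v with u ≟ v
... | yes u≡v = ⊥-elim (u≢v u≡v)
... | no _ = refl

-- All assignments of values in zs to the vertices in vs, extended by zero.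
assignments : List ℤ → List Vertex → List Heights
assignments zs []       = (λ _ → + 0) ∷ []
assignments zs (v ∷ vs) = concat (map (λ z → map (update v z) (assignments zs vs)) zs)

assignments-complete : ∀ zs vs (h : Heights) → (∀ v → v ∈ vs → h v ∈ zs) →
  ∃ λ g → g ∈ assignments zs vs × (∀ v → v ∈ vs → g v ≡ h v)
assignments-complete zs []       h h∈ = _ , here refl , λ _ ()
assignments-complete zs (v ∷ vs) h h∈
  with g , g∈ , g≡ ← assignments-complete zs vs h (λ u u∈ → h∈ u (there u∈))
  = update v (h v) g
  , ∈-concat⁺′ (∈-map⁺ (update v (h v)) g∈) (∈-map⁺ _ (h∈ v (here refl)))
  , agree
  where
  agree : ∀ u → u ∈ v ∷ vs → update v (h v) g u ≡ h u
  agree u u∈ with u ≟ v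
  ... | yes refl = refl
  agree u (here u≡v) | no u≢v = ⊥-elim (u≢v u≡v)
  agree u (there u∈) | no _   = g≡ u u∈

DifferOn : List Vertex → Heights → Heights → Set
DifferOn vs g h = ∃ λ v → v ∈ vs × g v ≢ h v

assignments-distinct : ∀ zs vs → Unique zs → Unique vs →
  AllPairs (DifferOn vs) (assignments zs vs)
assignments-distinct zs []       zs! vs!          = [] ∷ []
assignments-distinct zs (v ∷ vs) zs! (v∉ ∷ vs!) =
  AllPairs.concat⁺ (All.map⁺ (All.universal within zs))
                   (AllPairs.map⁺ (AllPairs.map across zs!))
  where
  within : ∀ z → AllPairs (DifferOn (v ∷ vs)) (map (update v z) (assignments zs vs))
  within z = AllPairs.map⁺ (AllPairs.map lift (assignments-distinct zs vs zs! vs!))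
    where
    lift : ∀ {g h} → DifferOn vs g h → DifferOn (v ∷ vs) (update v z g) (update v z h)
    lift {g} {h} (u , u∈ , g≢h) = u , there u∈ , λ eq →
      g≢h (trans (sym (update-other z g u≢v)) (trans eq (update-other z h u≢v)))
      where
      u≢v : u ≢ v
      u≢v u≡v = All.lookup v∉ u∈ (sym u≡v)

  across : ∀ {z z′} → z ≢ z′ →
    All (λ g → All (DifferOn (v ∷ vs) g) (map (update v z′) (assignments zs vs)))
        (map (update v z) (assignments zs vs))
  across {z} {z′} z≢z′ = All.map⁺ (All.universal (λ g → All.map⁺ (All.universal (λ h →
    v , here refl , λ eq →
      z≢z′ (trans (sym (update-same v z g)) (trans eq (update-same v z′ h)))) _)) _)

module _ (R : Region) where

  vertices : List Vertex
  vertices = deduplicate _≟_ (concatMap corners (squares R))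

  ∈-vertices : ∀ {v} → IsVertex R v → v ∈ vertices
  ∈-vertices {v} (d , s∈) = ∈-deduplicate⁺ _≟_
    (∈-concat⁺′ (∈-corners v d) (∈-map⁺ corners s∈))

  vertices-∈ : ∀ {v} → v ∈ vertices → IsVertex R v
  vertices-∈ {v} v∈
    with _ , v∈c , c∈ ← ∈-concat⁻′ (map corners (squares R)) (∈-deduplicate⁻ _≟_ _ v∈)
    with s , s∈ , refl ← ∈-map⁻ corners c∈
    with d , refl ← corners-∈ v s v∈c
    = d , s∈

  edge-source : ∀ {u d} → IsEdge R u d → IsVertex R u
  edge-source (inj₁ s∈) = _ , s∈
  edge-source (inj₂ s∈) = _ , s∈

  edge-target : ∀ {u d} → IsEdge R u d → IsVertex R (step u d)
  edge-target {u} {d} (inj₁ s∈) = turn d , subst (_∈ squares R) (sym (left-step-turn u d)) s∈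
  edge-target {u} {d} (inj₂ s∈) = opp d , subst (_∈ squares R) (sym (left-step-opp u d)) s∈

  boundary⇒edge : ∀ {u d} → IsBoundaryEdge R u d → IsEdge R u d
  boundary⇒edge (inj₁ (s∈ , _)) = inj₁ s∈
  boundary⇒edge (inj₂ (_ , s∈)) = inj₂ s∈

  isEdge? : ∀ u d → Dec (IsEdge R u d)
  isEdge? u d = (left u d ∈? squares R) ⊎-dec (right u d ∈? squares R)

  isBoundaryEdge? : ∀ u d → Dec (IsBoundaryEdge R u d)
  isBoundaryEdge? u d =
    ((left u d ∈? squares R) ×-dec ¬? (right u d ∈? squares R)) ⊎-dec
    (¬? (left u d ∈? squares R) ×-dec (right u d ∈? squares R))

  ∃dir? : {P : Dir → Set} → (∀ d → Dec (P d)) → Dec (∃ P)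
  ∃dir? P? = map′ (λ { (inj₁ p) → E , p ; (inj₂ (inj₁ p)) → N , p
                     ; (inj₂ (inj₂ (inj₁ p))) → W , p ; (inj₂ (inj₂ (inj₂ p))) → S , p })
                  (λ { (E , p) → inj₁ p ; (N , p) → inj₂ (inj₁ p)
                     ; (W , p) → inj₂ (inj₂ (inj₁ p)) ; (S , p) → inj₂ (inj₂ (inj₂ p)) })
                  (P? E ⊎-dec P? N ⊎-dec P? W ⊎-dec P? S)

  onBoundary? : ∀ v → Dec (OnBoundary R v)
  onBoundary? v = ∃dir? (isBoundaryEdge? v)

  black? : ∀ s → Dec (Black s)
  black? (x , y) = 2 ℕ.∣? ∣ x ℤ.+ y ∣

  extends? : ∀ f h → Dec (Extends R f h)
  extends? f h = map′ to from (All.all? local? vertices)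
    where
    EdgeCondition : Vertex → Dir → Set
    EdgeCondition u d =
      (IsBoundaryEdge R u d → ∣ h (step u d) ℤ.- h u ∣ ≡ 1) ×
      (IsEdge R u d → Black (left u d) →
        h (step u d) ≡ h u ℤ.+ + 1 ⊎ h (step u d) ≡ h u ℤ.- + 3)

    Local : Vertex → Set
    Local u = All (EdgeCondition u) dirs × (OnBoundary R u → h u ≡ f u)

    local? : ∀ u → Dec (Local u)
    local? u = All.all? (λ d →
        (isBoundaryEdge? u d →-dec (∣ h (step u d) ℤ.- h u ∣ ℕ.≟ 1)) ×-dec
        (isEdge? u d →-dec (black? (left u d) →-dec
          ((h (step u d) ℤ.≟ h u ℤ.+ + 1) ⊎-dec (h (step u d) ℤ.≟ h u ℤ.- + 3))))) dirs
      ×-dec (onBoundary? u →-dec (h u ℤ.≟ f u))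

    to : All Local vertices → Extends R f h
    to all = record
      { isHeight = record
        { boundary = λ u d b → proj₁ (All.lookup (proj₁ (at (boundary⇒edge b))) (∈-dirs d)) b
        ; black    = λ u d e → proj₂ (All.lookup (proj₁ (at e)) (∈-dirs d)) e
        }
      ; agrees = λ v (d , b) → proj₂ (at (boundary⇒edge b)) (d , b)
      }
      where
      at : ∀ {u d} → IsEdge R u d → Local u
      at e = All.lookup all (∈-vertices (edge-source e))

    from : Extends R f h → All Local vertices
    from ext = All.universal (λ u →
      All.universal (λ d → boundary u d , black u d) dirs , agrees u) vertices
      where
      open Extends ext
      open IsHeight isHeight

  extends-resp-≈ : ∀ {f g h} → _≈_ R g h → Extends R f h → Extends R f g
  extends-resp-≈ {f} {g} {h} g≈h ext = record
    { isHeight = record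
      { boundary = λ u d b → trans (cong₂ (λ i j → ∣ i ℤ.- j ∣)
          (g≈h _ (edge-target (boundary⇒edge b))) (g≈h _ (edge-source (boundary⇒edge b))))
          (boundary u d b)
      ; black = λ u d e bl → subst₂ (λ i j → i ≡ j ℤ.+ + 1 ⊎ i ≡ j ℤ.- + 3)
          (sym (g≈h _ (edge-target e))) (sym (g≈h _ (edge-source e))) (black u d e bl)
      }
    ; agrees = λ v (d , b) → trans (g≈h v (edge-source (boundary⇒edge b))) (agrees v (d , b))
    }
    where
    open Extends ext
    open IsHeight isHeight

  interior⇒westEdge : ∀ {v} → IsVertex R v → ¬ OnBoundary R v → left v W ∈ squares R
  interior⇒westEdge {v} (d , s∈) ¬b = go d s∈
    where
    next : ∀ d → left v d ∈ squares R → right v d ∈ squares R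
    next d s∈ with right v d ∈? squares R
    ... | yes t∈ = t∈
    ... | no  t∉ = ⊥-elim (¬b (d , inj₁ (s∈ , t∉)))

    go : ∀ d → left v d ∈ squares R → left v W ∈ squares R
    go E s∈ = next S (next E s∈)
    go N s∈ = next S (next E (next N s∈))
    go W s∈ = s∈
    go S s∈ = next S s∈

  west-bound : ∀ {h v} → IsHeight R h → IsEdge R v W →
    ∣ h v ∣ ℕ.≤ ∣ h (step v W) ∣ ℕ.+ 3
  west-bound {h} {v@(x , y)} H e = [ blackLeft , blackRight ]′ (left-or-right-black v)
    where
    open IsHeight H

    w : Vertex
    w = step v W

    from-diff : ∀ i j k → i ≡ j ℤ.+ k → ∣ k ∣ ℕ.≤ 3 → ∣ j ∣ ℕ.≤ ∣ i ∣ ℕ.+ 3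
    from-diff _ j k refl k≤3 =
      ℕ.≤-trans (∣i∣≤∣i+j∣+∣j∣ j k) (ℕ.+-monoʳ-≤ ∣ j ℤ.+ k ∣ k≤3)

    from-diff′ : ∀ i j k → j ≡ i ℤ.+ k → ∣ k ∣ ℕ.≤ 3 → ∣ j ∣ ℕ.≤ ∣ i ∣ ℕ.+ 3
    from-diff′ i _ k refl k≤3 =
      ℕ.≤-trans (ℤ.∣i+j∣≤∣i∣+∣j∣ i k) (ℕ.+-monoʳ-≤ ∣ i ∣ k≤3)

    blackLeft : Black (left v W) → ∣ h v ∣ ℕ.≤ ∣ h w ∣ ℕ.+ 3
    blackLeft b with black v W e b
    ... | inj₁ eq = from-diff (h w) (h v) (+ 1) eq (s≤s z≤n)
    ... | inj₂ eq = from-diff (h w) (h v) (ℤ.- + 3) eq ℕ.≤-refl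

    back : step w E ≡ v
    back = cong (_, y) (ℤ.suc-pred x)

    blackRight : Black (right v W) → ∣ h v ∣ ℕ.≤ ∣ h w ∣ ℕ.+ 3
    blackRight b with black w E (swap e) b
    ... | inj₁ eq = from-diff′ (h w) (h v) (+ 1) (trans (cong h (sym back)) eq) (s≤s z≤n)
    ... | inj₂ eq = from-diff′ (h w) (h v) (ℤ.- + 3) (trans (cong h (sym back)) eq) ℕ.≤-refl

  module _ (f : Heights) where

    private
      M X : ℕ
      M = maximum (λ v → ∣ f v ∣) vertices
      X = maximum (λ v → ∣ proj₁ v ∣) vertices

    bound : ℕ
    bound = M ℕ.+ suc (X ℕ.+ X) ℕ.* 3

    -- Walk west until the boundary is met.
    extension-bounded : ∀ {h} → Extends R f h → ∀ v → IsVertex R v → ∣ h v ∣ ℕ.≤ bound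
    extension-bounded {h} ext v iv = walk (suc (X ℕ.+ X)) v iv
        (ℤ.≤-<-trans (ℤ.+-monoˡ-≤ (+ X) (ℤ.≤-trans (i≤∣i∣ (proj₁ v)) (ℤ.+≤+ (x≤X iv))))
                     (ℤ.+<+ ℕ.≤-refl))
      where
      open Extends ext

      i≤∣i∣ : ∀ i → i ℤ.≤ + ∣ i ∣
      i≤∣i∣ (+ _)    = ℤ.≤-refl
      i≤∣i∣ -[1+ _ ] = ℤ.-≤+

      0≤i+n : ∀ i n → ∣ i ∣ ℕ.≤ n → + 0 ℤ.≤ i ℤ.+ + n
      0≤i+n (+ _)    n _ = ℤ.+≤+ z≤n
      0≤i+n -[1+ m ] n p = subst (+ 0 ℤ.≤_) (sym (ℤ.⊖-≥ p)) (ℤ.+≤+ z≤n)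

      x≤X : ∀ {v} → IsVertex R v → ∣ proj₁ v ∣ ℕ.≤ X
      x≤X iv = ≤-maximum (λ v → ∣ proj₁ v ∣) vertices (∈-vertices iv)

      walk : ∀ n v → IsVertex R v → proj₁ v ℤ.+ + X ℤ.< + n → ∣ h v ∣ ℕ.≤ M ℕ.+ n ℕ.* 3
      walk zero    v iv lt = ⊥-elim (ℤ.<⇒≱ lt (0≤i+n (proj₁ v) X (x≤X iv)))
      walk (suc n) v@(x , y) iv lt with onBoundary? v
      ... | yes b = ℕ.≤-trans (ℕ.≤-reflexive (cong ∣_∣ (agrees v b)))
                   (ℕ.≤-trans (≤-maximum (λ v → ∣ f v ∣) vertices (∈-vertices iv)) (ℕ.m≤m+n M _))
      ... | no ¬b = begin
        ∣ h v ∣                  ≤⟨ west-bound isHeight e ⟩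
        ∣ h (step v W) ∣ ℕ.+ 3   ≤⟨ ℕ.+-monoˡ-≤ 3 (walk n (step v W) (edge-target {v} {W} e) lt′) ⟩
        M ℕ.+ n ℕ.* 3 ℕ.+ 3      ≡⟨ ℕ.+-assoc M (n ℕ.* 3) 3 ⟩
        M ℕ.+ (n ℕ.* 3 ℕ.+ 3)    ≡⟨ cong (M ℕ.+_) (ℕ.+-comm (n ℕ.* 3) 3) ⟩
        M ℕ.+ suc n ℕ.* 3        ∎
        where
        open ℕ.≤-Reasoning

        e : IsEdge R v W
        e = inj₁ (interior⇒westEdge iv ¬b)

        lt′ : ℤ.pred x ℤ.+ + X ℤ.< + n
        lt′ = subst (ℤ._< + n) (sym (ℤ.+-assoc (ℤ.- + 1) x (+ X)))
                    (ℤ.+-monoʳ-< (ℤ.- + 1) lt)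

    enumeration : Enumeration R f
    enumeration = record
      { list     = filter (extends? f) candidates
      ; sound    = All.all-filter (extends? f) candidates
      ; complete = complete
      ; distinct = AllPairs.filter⁺ (extends? f) (AllPairs.map
          (λ (v , v∈ , g≢h) g≈h → g≢h (g≈h v (vertices-∈ v∈)))
          (assignments-distinct (ball bound) vertices (ball-unique bound)
            (UniqueDec.deduplicate-! (concatMap corners (squares R)))))
      }
      where
      candidates : List Heights
      candidates = assignments (ball bound) vertices

      complete : ∀ h → Extends R f h →
        ∃ λ g → g ∈ filter (extends? f) candidates × _≈_ R g h
      complete h ext
        with g , g∈ , g≡h ← assignments-complete (ball bound) vertices h
               (λ v v∈ → ∈-ball (h v) (extension-bounded ext v (vertices-∈ v∈)))
        = g , ∈-filter⁺ (extends? f) g∈ (extends-resp-≈ g≈h ext) , g≈h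
        where
        g≈h : _≈_ R g h
        g≈h v iv = g≡h v (∈-vertices iv)

μ : Region → Heights → Distribution Heights
μ R f = uniform (Enumeration.list (enumeration R f))

{-# OPTIONS --safe #-}
module Submission where

-- Let C = 2Δ₁ + Δ₂ + 1.  A suitable edge path between vertices at sup-norm distance n
-- raises a height function by at most 2n + 1.  Walking from a boundary vertex w of one
-- region towards the boundary of the other, until the latter is met, therefore gives
-- h₁ w − h₂ w ≤ C for all extensions h₁ of f₁ and h₂ of f₂.  This difference is a
-- multiple of 4, so it is at most D, the largest multiple of 4 not exceeding C.
--
-- If h₁ v > h₂ v + D, let K be the connected component of v in the set of common
-- vertices where h₁ ≠ h₂ + D.  On K we have h₁ > h₂ + D, so K avoids both boundaries,
-- and exchanging h₁ with h₂ + D on K gives a new pair of extensions for which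
-- h₁ v − h₂ v − D has changed sign.  The exchange does not change K, so it is an
-- involution: the pairs with a positive value of h₁ v − h₂ v − D are matched injectively
-- with pairs of opposite value, and the sum of this quantity over all pairs is at most 0.

open import Defs
open import Data.Bool using (Bool; true; false; not; _xor_; if_then_else_)
import Data.Bool.Properties as Bool
open import Data.Empty using (⊥-elim)
open import Data.Integer as ℤ using (ℤ; +_; -[1+_]; 0ℤ; ∣_∣)
import Data.Integer.DivMod as ℤ
open import Data.Integer.Divisibility using (_∣_)
import Data.Integer.Divisibility.Signed as Signed
import Data.Integer.Properties as ℤ
open import Data.Integer.Tactic.RingSolver using (solve-∀)
open import Data.List using (List; []; _∷_; _++_; map; foldr; length; cartesianProduct)
open import Data.List.Membership.DecPropositional _≟_ using (_∈?_)
open import Data.List.Membership.Propositional using (_∈_)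
open import Data.List.Membership.Propositional.Properties
open import Data.List.Relation.Unary.All as All using ()
open import Data.List.Relation.Unary.AllPairs using (AllPairs; []; _∷_)
open import Data.List.Relation.Unary.Any using (here; there)
import Data.List.Relation.Unary.Unique.Setoid.Properties as UniqueSetoid
open import Data.Nat as ℕ using (ℕ; zero; suc; z≤n; s≤s)
import Data.Nat.Divisibility as ℕ
import Data.Nat.Properties as ℕ
open import Data.Product using (∃; _×_; _,_; proj₁; proj₂)
open import Data.Rational as ℚ using (ℚ; mkℚ; 1ℚ; _/_)
import Data.Rational.Properties as ℚ
open import Data.Rational.Solver using (module +-*-Solver)
open import Data.Rational.Unnormalised as ℚᵘ using (mkℚᵘ)
import Data.Rational.Unnormalised.Properties as ℚᵘ
open import Data.Sum as Sum using (_⊎_; inj₁; inj₂; [_,_]′)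
open import Function using (id; _∘_)
open import Level using (0ℓ)
open import Relation.Binary.Bundles using (Setoid)
open import Relation.Binary.PropositionalEquality
import Relation.Binary.Reasoning.Setoid ℚᵘ.≃-setoid as ≃-Reasoning
open import Relation.Nullary using (¬_; Dec; yes; no; does)
open import Relation.Nullary.Decidable using (dec-true; dec-false; _×-dec_; _⊎-dec_; ¬?)
open +-*-Solver using (solve; _:+_; _:*_; _:-_; :-_; _:=_)

-- Linear inequalities and decidable reachability

-- The equation says that `j - i` and `l - k` coincide, so one linear inequality follows from
-- another by an identity that the ring solver can check.
≤-shift : ∀ {i j k l} → k ℤ.≤ l → i ℤ.+ l ≡ j ℤ.+ k → i ℤ.≤ j
≤-shift {i} {j} {k} {l} k≤l eq =
  ℤ.0≤i-j⇒j≤i (subst (0ℤ ℤ.≤_) l-k≡j-i (ℤ.i≤j⇒0≤j-i k≤l))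
  where
  rearrange : ∀ i j k l → l ℤ.- k ≡ (i ℤ.+ l) ℤ.- i ℤ.- k
  rearrange = solve-∀
  rearrange′ : ∀ i j k → (j ℤ.+ k) ℤ.- i ℤ.- k ≡ j ℤ.- i
  rearrange′ = solve-∀
  l-k≡j-i : l ℤ.- k ≡ j ℤ.- i
  l-k≡j-i = trans (rearrange i j k l)
              (trans (cong (λ x → x ℤ.- i ℤ.- k) eq) (rearrange′ i j k))

-- As in the Floyd–Warshall algorithm, the list holds the allowed intermediate
-- vertices; recursion on it makes reachability decidable without a bound on path lengths.
module Reachability {A : Set} (_~_ : A → A → Set) where

  Reachable : List A → A → A → Set
  Reachable []       x y = x ≡ y ⊎ x ~ y
  Reachable (z ∷ zs) x y = Reachable zs x y ⊎ (Reachable zs x z × Reachable zs z y)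

  reachable? : (∀ x y → Dec (x ≡ y)) → (∀ x y → Dec (x ~ y)) →
               ∀ zs x y → Dec (Reachable zs x y)
  reachable? _≟_ _~?_ []       x y = (x ≟ y) ⊎-dec (x ~? y)
  reachable? _≟_ _~?_ (z ∷ zs) x y =
    reachable? _≟_ _~?_ zs x y ⊎-dec
    (reachable? _≟_ _~?_ zs x z ×-dec reachable? _≟_ _~?_ zs z y)

  reachable-refl : ∀ zs {x} → Reachable zs x x
  reachable-refl []       = inj₁ refl
  reachable-refl (_ ∷ zs) = inj₁ (reachable-refl zs)

  reachable-edge : ∀ zs {x y} → x ~ y → Reachable zs x y
  reachable-edge []       e = inj₂ e
  reachable-edge (_ ∷ zs) e = inj₁ (reachable-edge zs e)

  -- The junction `y` becomes an intermediate vertex, so it has to be in the list. If both paths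
  -- pass through the head vertex, the detour between the two visits is dropped.
  reachable-trans : ∀ {zs x y w} → y ∈ zs →
    Reachable zs x y → Reachable zs y w → Reachable zs x w
  reachable-trans (here refl) p q =
    inj₂ ([ id , proj₁ ]′ p , [ id , proj₂ ]′ q)
  reachable-trans (there y∈) (inj₁ p)       (inj₁ q)       = inj₁ (reachable-trans y∈ p q)
  reachable-trans (there y∈) (inj₁ p)       (inj₂ (q , r)) = inj₂ (reachable-trans y∈ p q , r)
  reachable-trans (there y∈) (inj₂ (p , q)) (inj₁ r)       = inj₂ (p , reachable-trans y∈ q r)
  reachable-trans (there y∈) (inj₂ (p , _)) (inj₂ (_ , r)) = inj₂ (p , r)

  reachable-invariant : (P : A → Set) → (∀ {x y} → x ~ y → P x → P y) →
    ∀ zs {x y} → Reachable zs x y → P x → P y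
  reachable-invariant P step []       (inj₁ refl)    = id
  reachable-invariant P step []       (inj₂ e)       = step e
  reachable-invariant P step (z ∷ zs) (inj₁ p)       = reachable-invariant P step zs p
  reachable-invariant P step (z ∷ zs) (inj₂ (p , q)) =
    reachable-invariant P step zs q ∘ reachable-invariant P step zs p

open Reachability

reachable-map : {A : Set} {_~_ _≈_ : A → A → Set} → (∀ {x y} → x ~ y → x ≈ y) →
  ∀ zs {x y} → Reachable _~_ zs x y → Reachable _≈_ zs x y
reachable-map f []       = Sum.map₂ f
reachable-map f (_ ∷ zs) = Sum.map (reachable-map f zs)
  (λ (p , q) → reachable-map f zs p , reachable-map f zs q)

-- Integer sums over lists, and matchings of their terms

∑ : {A : Set} → List A → (A → ℤ) → ℤ
∑ xs φ = foldr (λ x s → φ x ℤ.+ s) 0ℤ xs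

module _ {A : Set} where

  ∑-++ : ∀ (φ : A → ℤ) xs ys → ∑ (xs ++ ys) φ ≡ ∑ xs φ ℤ.+ ∑ ys φ
  ∑-++ φ []       ys = sym (ℤ.+-identityˡ _)
  ∑-++ φ (x ∷ xs) ys = trans (cong (ℤ._+_ (φ x)) (∑-++ φ xs ys)) (sym (ℤ.+-assoc (φ x) _ _))

  ∑-map : ∀ {B : Set} (φ : B → ℤ) (g : A → B) xs → ∑ (map g xs) φ ≡ ∑ xs (φ ∘ g)
  ∑-map φ g []       = refl
  ∑-map φ g (x ∷ xs) = cong (ℤ._+_ (φ (g x))) (∑-map φ g xs)

  ∑-remove : ∀ (φ : A → ℤ) xs {y ys} → ∑ (xs ++ y ∷ ys) φ ≡ φ y ℤ.+ ∑ (xs ++ ys) φ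
  ∑-remove φ xs {y} {ys} = trans (∑-++ φ xs (y ∷ ys))
    (trans (swap (∑ xs φ) (φ y) (∑ ys φ)) (cong (ℤ._+_ (φ y)) (sym (∑-++ φ xs ys))))
    where
    swap : ∀ i j k → i ℤ.+ (j ℤ.+ k) ≡ j ℤ.+ (i ℤ.+ k)
    swap = solve-∀

  ∑-nonneg : ∀ (φ : A → ℤ) → (∀ x → 0ℤ ℤ.≤ φ x) → ∀ xs → 0ℤ ℤ.≤ ∑ xs φ
  ∑-nonneg φ φ≥0 []       = ℤ.≤-refl
  ∑-nonneg φ φ≥0 (x ∷ xs) = ℤ.+-mono-≤ (φ≥0 x) (∑-nonneg φ φ≥0 xs)

  -- Each positive term on the left is charged to its own term on the right, which is then removed;
  -- the terms never charged are nonnegative. A relation `⇝` takes the place of a function because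
  -- partners are determined only up to an equivalence.
  ∑-injection : (_≋_ _⇝_ : A → A → Set) → (∀ {x x′ y} → x ⇝ y → x′ ⇝ y → x ≋ x′) →
    ∀ (φ ψ : A → ℤ) → (∀ y → 0ℤ ℤ.≤ ψ y) →
    ∀ xs ys → AllPairs (λ x x′ → ¬ (x ≋ x′)) xs →
    (∀ x → x ∈ xs → φ x ℤ.≤ 0ℤ ⊎ ∃ λ y → y ∈ ys × x ⇝ y × φ x ℤ.≤ ψ y) →
    ∑ xs φ ℤ.≤ ∑ ys ψ
  ∑-injection _≋_ _⇝_ inj φ ψ ψ≥0 = go
    where
    go : ∀ xs ys → AllPairs (λ x x′ → ¬ (x ≋ x′)) xs →
         (∀ x → x ∈ xs → φ x ℤ.≤ 0ℤ ⊎ ∃ λ y → y ∈ ys × x ⇝ y × φ x ℤ.≤ ψ y) →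
         ∑ xs φ ℤ.≤ ∑ ys ψ
    go []       ys xs! h = ∑-nonneg ψ ψ≥0 ys
    go (x ∷ xs) ys (x≉ ∷ xs!) h with h x (here refl)
    ... | inj₁ φx≤0 = subst (φ x ℤ.+ ∑ xs φ ℤ.≤_) (ℤ.+-identityˡ (∑ ys ψ))
                        (ℤ.+-mono-≤ φx≤0 (go xs ys xs! (λ x′ → h x′ ∘ there)))
    ... | inj₂ (y , y∈ , x⇝y , φx≤ψy) with as , bs , refl ← ∈-∃++ y∈ =
      subst (φ x ℤ.+ ∑ xs φ ℤ.≤_) (sym (∑-remove ψ as))
        (ℤ.+-mono-≤ φx≤ψy (go xs (as ++ bs) xs! h′))
      where
      remains : ∀ {y′} → y′ ∈ as ++ y ∷ bs → y′ ≢ y → y′ ∈ as ++ bs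
      remains y′∈ y′≢y with ∈-++⁻ as y′∈
      ... | inj₁ p         = ∈-++⁺ˡ p
      ... | inj₂ (here eq) = ⊥-elim (y′≢y eq)
      ... | inj₂ (there p) = ∈-++⁺ʳ as p

      h′ : ∀ x′ → x′ ∈ xs → φ x′ ℤ.≤ 0ℤ ⊎ ∃ λ y′ → y′ ∈ as ++ bs × x′ ⇝ y′ × φ x′ ℤ.≤ ψ y′
      -- If the partner of `x′` were the removed `y`, injectivity would give `x ≋ x′`, contrary to
      -- distinctness.
      h′ x′ x′∈ = Sum.map₂ (λ (y′ , y′∈ , x′⇝y′ , le) →
        y′ , remains y′∈ (λ { refl → All.lookup x≉ x′∈ (inj x⇝y x′⇝y′) }) , x′⇝y′ , le)
        (h x′ (there x′∈))

_⁺ : ℤ → ℤ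
(+ n) ⁺    = + n
-[1+ n ] ⁺ = 0ℤ

⁺-nonneg : ∀ i → 0ℤ ℤ.≤ i ⁺
⁺-nonneg (+ n)    = ℤ.+≤+ ℕ.z≤n
⁺-nonneg -[1+ n ] = ℤ.≤-refl

-- The term `(- i) ⁺` is the negative part of `i`.
⁺-decompose : ∀ i → i ℤ.+ (ℤ.- i) ⁺ ≡ i ⁺
⁺-decompose (+ zero)  = refl
⁺-decompose (+ suc n) = ℤ.+-identityʳ _
⁺-decompose -[1+ n ]  = ℤ.+-inverseˡ (+ suc n)

-- The positive part of `φ` at an entry equals the negative part at its partner, so the positive
-- parts have at most the sum of the negative parts.
∑-negating : {A : Set} (_≋_ _⇝_ : A → A → Set) →
  (∀ {x x′ y} → x ⇝ y → x′ ⇝ y → x ≋ x′) →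
  ∀ (φ : A → ℤ) xs → AllPairs (λ x x′ → ¬ (x ≋ x′)) xs →
  (∀ x → x ∈ xs → 0ℤ ℤ.< φ x → ∃ λ y → y ∈ xs × x ⇝ y × φ y ≡ ℤ.- φ x) →
  ∑ xs φ ℤ.≤ 0ℤ
∑-negating _≋_ _⇝_ inj φ xs xs! partner =
  ≤-shift (∑-injection _≋_ _⇝_ inj φ⁺ φ⁻ (λ y → ⁺-nonneg (ℤ.- φ y)) xs xs xs! partner⁺)
          (trans (∑-decompose xs) (sym (ℤ.+-identityˡ _)))
  where
  φ⁺ φ⁻ : _ → ℤ
  φ⁺ x = φ x ⁺
  φ⁻ x = (ℤ.- φ x) ⁺

  ∑-decompose : ∀ ys → ∑ ys φ ℤ.+ ∑ ys φ⁻ ≡ ∑ ys φ⁺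
  ∑-decompose []       = refl
  ∑-decompose (y ∷ ys) = trans (interchange (φ y) _ (φ⁻ y) _)
                               (cong₂ ℤ._+_ (⁺-decompose (φ y)) (∑-decompose ys))
    where
    interchange : ∀ i j k l → (i ℤ.+ j) ℤ.+ (k ℤ.+ l) ≡ (i ℤ.+ k) ℤ.+ (j ℤ.+ l)
    interchange = solve-∀

  partner⁺ : ∀ x → x ∈ xs → φ⁺ x ℤ.≤ 0ℤ ⊎ ∃ λ y → y ∈ xs × x ⇝ y × φ⁺ x ℤ.≤ φ⁻ y
  partner⁺ x x∈ with 0ℤ ℤ.<? φ x
  ... | no φx≤0 with φ x | ℤ.≮⇒≥ φx≤0
  ...   | + n      | le = inj₁ le
  ...   | -[1+ _ ] | _  = inj₁ ℤ.≤-refl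
  partner⁺ x x∈ | yes φx>0 with y , y∈ , x⇝y , φy≡ ← partner x x∈ φx>0 =
    inj₂ (y , y∈ , x⇝y , ℤ.≤-reflexive
      (cong _⁺ (sym (trans (cong ℤ.-_ φy≡) (ℤ.neg-involutive (φ x))))))

module _ {A B : Set} where

  -- For nonempty lists, division by both lengths turns the right side into a difference of
  -- averages; the sign of the total over all pairs thus compares the averages.
  ∑-cartesianProduct : ∀ (φ : A → ℤ) (ψ : B → ℤ) xs ys →
    ∑ (cartesianProduct xs ys) (λ (x , y) → φ x ℤ.- ψ y) ≡
    + length ys ℤ.* ∑ xs φ ℤ.- + length xs ℤ.* ∑ ys ψ
  ∑-cartesianProduct φ ψ []       ys = begin
    0ℤ                                              ≡⟨ ℤ.*-zeroʳ (+ length ys) ⟨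
    + length ys ℤ.* 0ℤ                              ≡⟨ ℤ.+-identityʳ _ ⟨
    + length ys ℤ.* 0ℤ ℤ.- 0ℤ ℤ.* ∑ ys ψ            ∎
    where open ≡-Reasoning
  ∑-cartesianProduct φ ψ (x ∷ xs) ys = begin
    ∑ (map (x ,_) ys ++ cartesianProduct xs ys) χ
      ≡⟨ ∑-++ χ (map (x ,_) ys) (cartesianProduct xs ys) ⟩
    ∑ (map (x ,_) ys) χ ℤ.+ ∑ (cartesianProduct xs ys) χ
      ≡⟨ cong₂ ℤ._+_ (trans (∑-map χ (x ,_) ys) (row ys)) (∑-cartesianProduct φ ψ xs ys) ⟩
    (n ℤ.* φ x ℤ.- ∑ ys ψ) ℤ.+ (n ℤ.* ∑ xs φ ℤ.- + length xs ℤ.* ∑ ys ψ)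
      ≡⟨ collect n (φ x) (∑ ys ψ) (∑ xs φ) (+ length xs) ⟩
    n ℤ.* (φ x ℤ.+ ∑ xs φ) ℤ.- + suc (length xs) ℤ.* ∑ ys ψ
      ∎
    where
    open ≡-Reasoning
    n = + length ys
    χ : A × B → ℤ
    χ (x , y) = φ x ℤ.- ψ y

    collect : ∀ n a s t m →
      (n ℤ.* a ℤ.- s) ℤ.+ (n ℤ.* t ℤ.- m ℤ.* s) ≡ n ℤ.* (a ℤ.+ t) ℤ.- (+ 1 ℤ.+ m) ℤ.* s
    collect = solve-∀

    row : ∀ zs → ∑ zs (λ y → φ x ℤ.- ψ y) ≡ + length zs ℤ.* φ x ℤ.- ∑ zs ψ
    row []       = refl
    row (z ∷ zs) = trans (cong (ℤ._+_ (φ x ℤ.- ψ z)) (row zs))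
                         (one-more (φ x) (ψ z) (+ length zs) (∑ zs ψ))
      where
      one-more : ∀ a b k s → a ℤ.- b ℤ.+ (k ℤ.* a ℤ.- s) ≡ (+ 1 ℤ.+ k) ℤ.* a ℤ.- (b ℤ.+ s)
      one-more = solve-∀

-- Integers in ℚ and expectations under uniform distributions

ι : ℤ → ℚ
ι i = i / 1

-- Facts about embedded integers are checked on unnormalised fractions with denominator 1, where
-- they become facts about integers.
toℚᵘ-ι : ∀ i → ℚ.toℚᵘ (ι i) ℚᵘ.≃ mkℚᵘ i 0
toℚᵘ-ι i = ℚ.toℚᵘ-fromℚᵘ (mkℚᵘ i 0)

ι-+ : ∀ i j → ι (i ℤ.+ j) ≡ ι i ℚ.+ ι j
ι-+ i j = ℚ.toℚᵘ-injective (begin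
  ℚ.toℚᵘ (ι (i ℤ.+ j))            ≈⟨ toℚᵘ-ι (i ℤ.+ j) ⟩
  mkℚᵘ (i ℤ.+ j) 0                ≈⟨ ℚᵘ.*≡* (identity i j) ⟩
  mkℚᵘ i 0 ℚᵘ.+ mkℚᵘ j 0          ≈⟨ ℚᵘ.+-cong (toℚᵘ-ι i) (toℚᵘ-ι j) ⟨
  ℚ.toℚᵘ (ι i) ℚᵘ.+ ℚ.toℚᵘ (ι j)  ≈⟨ ℚ.toℚᵘ-homo-+ (ι i) (ι j) ⟨
  ℚ.toℚᵘ (ι i ℚ.+ ι j)            ∎)
  where
  open ≃-Reasoning
  identity : ∀ i j → (i ℤ.+ j) ℤ.* + 1 ≡ (i ℤ.* + 1 ℤ.+ j ℤ.* + 1) ℤ.* + 1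
  identity = solve-∀

ι-* : ∀ i j → ι (i ℤ.* j) ≡ ι i ℚ.* ι j
ι-* i j = ℚ.toℚᵘ-injective (begin
  ℚ.toℚᵘ (ι (i ℤ.* j))            ≈⟨ toℚᵘ-ι (i ℤ.* j) ⟩
  mkℚᵘ i 0 ℚᵘ.* mkℚᵘ j 0          ≈⟨ ℚᵘ.*-cong (toℚᵘ-ι i) (toℚᵘ-ι j) ⟨
  ℚ.toℚᵘ (ι i) ℚᵘ.* ℚ.toℚᵘ (ι j)  ≈⟨ ℚ.toℚᵘ-homo-* (ι i) (ι j) ⟨
  ℚ.toℚᵘ (ι i ℚ.* ι j)            ∎)
  where open ≃-Reasoning

ι-mono-≤ : ∀ {i j} → i ℤ.≤ j → ι i ℚ.≤ ι j
ι-mono-≤ {i} {j} i≤j = ℚ.toℚᵘ-cancel-≤ (begin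
  ℚ.toℚᵘ (ι i) ≃⟨ toℚᵘ-ι i ⟩
  mkℚᵘ i 0     ≤⟨ ℚᵘ.*≤* (ℤ.*-monoʳ-≤-nonNeg (+ 1) i≤j) ⟩
  mkℚᵘ j 0     ≃⟨ toℚᵘ-ι j ⟨
  ℚ.toℚᵘ (ι j) ∎)
  where open ℚᵘ.≤-Reasoning

1/n*n : ∀ n → (+ 1 / suc n) ℚ.* ι (+ suc n) ≡ 1ℚ
1/n*n n = ℚ.toℚᵘ-injective (begin
  ℚ.toℚᵘ ((+ 1 / suc n) ℚ.* ι (+ suc n))
    ≈⟨ ℚ.toℚᵘ-homo-* (+ 1 / suc n) (ι (+ suc n)) ⟩
  ℚ.toℚᵘ (+ 1 / suc n) ℚᵘ.* ℚ.toℚᵘ (ι (+ suc n))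
    ≈⟨ ℚᵘ.*-cong (ℚ.toℚᵘ-fromℚᵘ (mkℚᵘ (+ 1) n)) (toℚᵘ-ι (+ suc n)) ⟩
  mkℚᵘ (+ 1) n ℚᵘ.* mkℚᵘ (+ suc n) 0
    ≈⟨ ℚᵘ.*≡* (cong (+_ ∘ suc) (identity n)) ⟩
  ℚ.toℚᵘ 1ℚ ∎)
  where
  open ≃-Reasoning
  identity : ∀ n → (n ℕ.+ 0) ℕ.* 1 ≡ n ℕ.* 1 ℕ.+ 0
  identity n = trans (ℕ.*-identityʳ (n ℕ.+ 0)) (cong (ℕ._+ 0) (sym (ℕ.*-identityʳ n)))

0≤1/n : ∀ n → ℚ.NonNegative (+ 1 / suc n)
0≤1/n n = ℚ.normalize-nonNeg 1 (suc n)

-- The quotient `k` is the floor of the numerator of `C` divided by `n` times its denominator.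
multiple-below : ∀ n .{{_ : ℕ.NonZero n}} C → ∃ λ k →
  ι (+ n ℤ.* k) ℚ.≤ C × (∀ q → ι (+ n ℤ.* q) ℚ.≤ C → q ℤ.≤ k)
multiple-below n C@(mkℚ c d-1 _) = k , lower , greatest
  where
  m : ℕ
  m = n ℕ.* suc d-1

  instance
    m≢0 : ℕ.NonZero m
    m≢0 = ℕ.m*n≢0 n (suc d-1)

  k : ℤ
  k = c ℤ./ℕ m

  regroup : ∀ q → + n ℤ.* q ℤ.* + suc d-1 ≡ q ℤ.* + m
  regroup q = trans (identity (+ n) q (+ suc d-1)) (cong (q ℤ.*_) (sym (ℤ.pos-* n (suc d-1))))
    where
    identity : ∀ x q y → x ℤ.* q ℤ.* y ≡ q ℤ.* (x ℤ.* y)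
    identity = solve-∀

  lower : ι (+ n ℤ.* k) ℚ.≤ C
  lower = ℚ.toℚᵘ-cancel-≤ (begin
    ℚ.toℚᵘ (ι (+ n ℤ.* k)) ≃⟨ toℚᵘ-ι (+ n ℤ.* k) ⟩
    mkℚᵘ (+ n ℤ.* k) 0     ≤⟨ ℚᵘ.*≤* (subst₂ ℤ._≤_ (sym (regroup k)) (sym (ℤ.*-identityʳ c))
                               (ℤ.[n/ℕd]*d≤n c m)) ⟩
    ℚ.toℚᵘ C               ∎)
    where open ℚᵘ.≤-Reasoning

  greatest : ∀ q → ι (+ n ℤ.* q) ℚ.≤ C → q ℤ.≤ k
  greatest q nq≤C with ℚᵘ.≤-respˡ-≃ (toℚᵘ-ι (+ n ℤ.* q)) (ℚ.toℚᵘ-mono-≤ nq≤C)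
  -- If `k < q`, then `(k + 1) * m ≤ q * m ≤ c`, whereas the floor satisfies `c < (k + 1) * m`.
  ... | ℚᵘ.*≤* le = ℤ.≮⇒≥ λ k<q → ℤ.<⇒≱ (ℤ.n<s[n/ℕd]*d c m)
    (ℤ.≤-trans (ℤ.*-monoʳ-≤-nonNeg (+ m) (ℤ.i<j⇒suc[i]≤j k<q))
      (subst₂ ℤ._≤_ (regroup q) (ℤ.*-identityʳ c) le))

𝔼-uniform : {A : Set} (φ : A → ℤ) (x : A) (xs : List A) →
  𝔼 (uniform (x ∷ xs)) (ι ∘ φ) ≡ (+ 1 / suc (length xs)) ℚ.* ι (∑ (x ∷ xs) φ)
𝔼-uniform {A} φ x xs = weighted (+ 1 / suc (length xs)) (x ∷ xs)
  where
  weighted : ∀ p (ys : List A) → 𝔼 (map (_, p) ys) (ι ∘ φ) ≡ p ℚ.* ι (∑ ys φ)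
  weighted p []       = sym (ℚ.*-zeroʳ p)
  weighted p (y ∷ ys) = begin
    p ℚ.* ι (φ y) ℚ.+ 𝔼 (map (_, p) ys) (ι ∘ φ) ≡⟨ cong (p ℚ.* ι (φ y) ℚ.+_) (weighted p ys) ⟩
    p ℚ.* ι (φ y) ℚ.+ p ℚ.* ι (∑ ys φ)          ≡⟨ ℚ.*-distribˡ-+ p _ _ ⟨
    p ℚ.* (ι (φ y) ℚ.+ ι (∑ ys φ))              ≡⟨ cong (p ℚ.*_) (ι-+ (φ y) (∑ ys φ)) ⟨
    p ℚ.* ι (φ y ℤ.+ ∑ ys φ)                    ∎
    where open ≡-Reasoning

-- The weights of a nonempty list add up to 1, so the shift survives in full; on an empty list the
-- expectation is 0 and the shift would be lost.
𝔼-uniform-+ : {A : Set} (φ : A → ℤ) (D : ℤ) (x : A) (xs : List A) →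
  𝔼 (uniform (x ∷ xs)) (λ y → ι (φ y ℤ.+ D)) ≡ 𝔼 (uniform (x ∷ xs)) (ι ∘ φ) ℚ.+ ι D
𝔼-uniform-+ {A} φ D x xs = begin
  𝔼 (uniform (x ∷ xs)) (λ y → ι (φ y ℤ.+ D)) ≡⟨ 𝔼-uniform (λ y → φ y ℤ.+ D) x xs ⟩
  p ℚ.* ι (∑ (x ∷ xs) (λ y → φ y ℤ.+ D))     ≡⟨ cong (λ i → p ℚ.* ι i) (∑-shift (x ∷ xs)) ⟩
  p ℚ.* ι (s ℤ.+ n ℤ.* D)                    ≡⟨ cong (p ℚ.*_)
                                                  (trans (ι-+ s (n ℤ.* D))
                                                         (cong (ι s ℚ.+_) (ι-* n D))) ⟩
  p ℚ.* (ι s ℚ.+ ι n ℚ.* ι D)                ≡⟨ expand p (ι s) (ι n) (ι D) ⟩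
  p ℚ.* ι s ℚ.+ p ℚ.* ι n ℚ.* ι D            ≡⟨ cong₂ (λ a b → a ℚ.+ b ℚ.* ι D)
                                                  (sym (𝔼-uniform φ x xs)) (1/n*n (length xs)) ⟩
  𝔼 (uniform (x ∷ xs)) (ι ∘ φ) ℚ.+ 1ℚ ℚ.* ι D
                                             ≡⟨ cong (𝔼 (uniform (x ∷ xs)) (ι ∘ φ) ℚ.+_)
                                                  (ℚ.*-identityˡ (ι D)) ⟩
  𝔼 (uniform (x ∷ xs)) (ι ∘ φ) ℚ.+ ι D       ∎
  where
  open ≡-Reasoning
  p = + 1 / suc (length xs)
  n s : ℤ
  n = + suc (length xs)
  s = ∑ (x ∷ xs) φ

  ∑-shift : ∀ (ys : List A) → ∑ ys (λ y → φ y ℤ.+ D) ≡ ∑ ys φ ℤ.+ + length ys ℤ.* D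
  ∑-shift []       = refl
  ∑-shift (y ∷ ys) = trans (cong (ℤ._+_ (φ y ℤ.+ D)) (∑-shift ys))
                           (identity (φ y) D (∑ ys φ) (+ length ys))
    where
    identity : ∀ a D s k → a ℤ.+ D ℤ.+ (s ℤ.+ k ℤ.* D) ≡ a ℤ.+ s ℤ.+ (+ 1 ℤ.+ k) ℤ.* D
    identity = solve-∀

  expand : ∀ p s n D → p ℚ.* (s ℚ.+ n ℚ.* D) ≡ p ℚ.* s ℚ.+ p ℚ.* n ℚ.* D
  expand = solve 4 (λ p s n D → p :* (s :+ n :* D) :=
                              p :* s :+ p :* n :* D) refl

-- The hypothesis amounts to `n * s ≤ m * t`, with `m` and `n` the lengths and `s` and `t` the sums;
-- multiplying by `1 / m` and `1 / n` gives the averages.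
𝔼-uniform-≤ : {A B : Set} (φ : A → ℤ) (ψ : B → ℤ) (x : A) (xs : List A) (y : B) (ys : List B) →
  ∑ (cartesianProduct (x ∷ xs) (y ∷ ys)) (λ (a , b) → φ a ℤ.- ψ b) ℤ.≤ 0ℤ →
  𝔼 (uniform (x ∷ xs)) (ι ∘ φ) ℚ.≤ 𝔼 (uniform (y ∷ ys)) (ι ∘ ψ)
𝔼-uniform-≤ φ ψ x xs y ys ∑≤0 = begin
  𝔼 (uniform (x ∷ xs)) (ι ∘ φ)  ≡⟨ 𝔼-uniform φ x xs ⟩
  p ℚ.* ι s                     ≡⟨ cancel q n p s (1/n*n (length ys)) ⟨
  q ℚ.* (p ℚ.* ι (n ℤ.* s))     ≤⟨ ℚ.*-monoˡ-≤-nonNeg q {{0≤1/n (length ys)}}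
                                     (ℚ.*-monoˡ-≤-nonNeg p {{0≤1/n (length xs)}} (ι-mono-≤ ns≤mt)) ⟩
  q ℚ.* (p ℚ.* ι (m ℤ.* t))     ≡⟨ swap q p (ι (m ℤ.* t)) ⟩
  p ℚ.* (q ℚ.* ι (m ℤ.* t))     ≡⟨ cancel p m q t (1/n*n (length xs)) ⟩
  q ℚ.* ι t                     ≡⟨ 𝔼-uniform ψ y ys ⟨
  𝔼 (uniform (y ∷ ys)) (ι ∘ ψ)  ∎
  where
  open ℚ.≤-Reasoning
  p q : ℚ
  p = + 1 / suc (length xs)
  q = + 1 / suc (length ys)
  m n s t : ℤ
  m = + suc (length xs)
  n = + suc (length ys)
  s = ∑ (x ∷ xs) φ
  t = ∑ (y ∷ ys) ψ

  ns≤mt : n ℤ.* s ℤ.≤ m ℤ.* t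
  ns≤mt = ℤ.i-j≤0⇒i≤j (subst (ℤ._≤ 0ℤ) (∑-cartesianProduct φ ψ (x ∷ xs) (y ∷ ys)) ∑≤0)

  swap : ∀ a b c → a ℚ.* (b ℚ.* c) ≡ b ℚ.* (a ℚ.* c)
  swap = solve 3 (λ a b c → a :* (b :* c) := b :* (a :* c)) refl

  cancel : ∀ a k b i → a ℚ.* ι k ≡ 1ℚ → a ℚ.* (b ℚ.* ι (k ℤ.* i)) ≡ b ℚ.* ι i
  cancel a k b i ak≡1 = trans (cong (λ r → a ℚ.* (b ℚ.* r)) (ι-* k i))
    (trans (regroup a b (ι k) (ι i))
    (trans (cong (ℚ._* (b ℚ.* ι i)) ak≡1) (ℚ.*-identityˡ _)))
    where
    regroup : ∀ a b k i → a ℚ.* (b ℚ.* (k ℚ.* i)) ≡ a ℚ.* k ℚ.* (b ℚ.* i)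
    regroup = solve 4 (λ a b k i → a :* (b :* (k :* i)) :=
                                       a :* k :* (b :* i)) refl

-- Colours, edges and boundary vertices

even-suc : ∀ z → + 2 ∣ z → ¬ (+ 2 ∣ ℤ.suc z)
even-suc z 2∣z 2∣1+z = ℕ.>⇒∤ (s≤s (s≤s z≤n))
  (Signed.∣⇒∣ᵤ {+ 2} {+ 1} (Signed.∣m+n∣n⇒∣m {+ 2} {+ 1} {z} (Signed.∣ᵤ⇒∣ 2∣1+z) (Signed.∣ᵤ⇒∣ 2∣z)))

does-sound : {A : Set} (a? : Dec A) → does a? ≡ true → A
does-sound (yes a) _ = a

does-complement : {A B : Set} (a? : Dec A) (b? : Dec B) → (A → ¬ B) → A ⊎ B →
                  does b? ≡ not (does a?)
does-complement (yes a) b? disjoint _         = dec-false b? (disjoint a)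
does-complement (no ¬a) b? disjoint (inj₁ a)  = ⊥-elim (¬a a)
does-complement (no ¬a) b? disjoint (inj₂ b)  = dec-true b? b

even? : ∀ z → Dec (+ 2 ∣ z)
even? z = 2 ℕ.∣? ∣ z ∣

-- The Boolean form of `Black` allows colours along a walk to be computed with `not` and `xor`.
black : Square → Bool
black (x , y) = does (even? (x ℤ.+ y))

black-sound : ∀ s → black s ≡ true → Black s
black-sound (x , y) = does-sound (even? (x ℤ.+ y))

even-suc-complement : ∀ z → does (even? (ℤ.suc z)) ≡ not (does (even? z))
even-suc-complement z =
  does-complement (even? z) (even? (ℤ.suc z)) (even-suc z) (even-or-suc-even z)

even-pred-complement : ∀ z → does (even? (ℤ.pred z)) ≡ not (does (even? z))
even-pred-complement z = Bool.not-injective (trans (sym (even-suc-complement (ℤ.pred z)))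
  (trans (cong (does ∘ even?) (ℤ.suc-pred z)) (sym (Bool.not-involutive _))))

black-step : ∀ s d → black (step s d) ≡ not (black s)
black-step (x , y) E = trans (cong (does ∘ even?) (eq x y)) (even-suc-complement (x ℤ.+ y))
  where
  eq : ∀ x y → (+ 1 ℤ.+ x) ℤ.+ y ≡ + 1 ℤ.+ (x ℤ.+ y)
  eq = solve-∀
black-step (x , y) N = trans (cong (does ∘ even?) (eq x y)) (even-suc-complement (x ℤ.+ y))
  where
  eq : ∀ x y → x ℤ.+ (+ 1 ℤ.+ y) ≡ + 1 ℤ.+ (x ℤ.+ y)
  eq = solve-∀
black-step (x , y) W = trans (cong (does ∘ even?) (eq x y)) (even-pred-complement (x ℤ.+ y))
  where
  eq : ∀ x y → (-[1+ 0 ] ℤ.+ x) ℤ.+ y ≡ -[1+ 0 ] ℤ.+ (x ℤ.+ y)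
  eq = solve-∀
black-step (x , y) S = trans (cong (does ∘ even?) (eq x y)) (even-pred-complement (x ℤ.+ y))
  where
  eq : ∀ x y → x ℤ.+ (-[1+ 0 ] ℤ.+ y) ≡ -[1+ 0 ] ℤ.+ (x ℤ.+ y)
  eq = solve-∀

vertical : Dir → Bool
vertical E = false
vertical N = true
vertical W = false
vertical S = true

-- Here `u` is also read as the square with that lower-left corner. The square to the left of a
-- horizontal edge is this one or a diagonal neighbour, of the same colour; for a vertical edge it
-- is an adjacent one.
black-left : ∀ u d → black (left u d) ≡ vertical d xor black u
black-left u E = refl
black-left u N = black-step u W
black-left u W = trans (black-step (step u W) S)
                   (trans (cong not (black-step u W)) (Bool.not-involutive (black u)))
black-left u S = black-step u S

black-left-step : ∀ u d e → black (left (step u d) e) ≡ not (vertical e xor black u)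
black-left-step u d e = trans (black-left (step u d) e)
  (trans (cong (vertical e xor_) (black-step u d)) (flip (vertical e) (black u)))
  where
  flip : ∀ a b → a xor not b ≡ not (a xor b)
  flip false b = refl
  flip true  b = refl

black-right : ∀ u d → black (right u d) ≡ not (black (left u d))
black-right u E = black-step u S
black-right u N = sym (trans (cong not (black-step u W)) (Bool.not-involutive (black u)))
black-right u W =
  (sym (trans (cong not (black-step (step u W) S)) (Bool.not-involutive _)))
black-right u S = black-step (step u S) W

step-opp : ∀ u d → step (step u d) (opp d) ≡ u
step-opp (x , y) E = cong (_, y) (ℤ.pred-suc x)
step-opp (x , y) N = cong (x ,_) (ℤ.pred-suc y)
step-opp (x , y) W = cong (_, y) (ℤ.suc-pred x)
step-opp (x , y) S = cong (x ,_) (ℤ.suc-pred y)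

right-step-opp : ∀ u d → right (step u d) (opp d) ≡ left u d
right-step-opp u d = trans (cong (left (step u d)) (turn⁴ d)) (left-step-turn u d)
  where
  turn⁴ : ∀ d → turn (opp (opp d)) ≡ turn d
  turn⁴ E = refl
  turn⁴ N = refl
  turn⁴ W = refl
  turn⁴ S = refl

module _ (R : Region) where

  edge-opp : ∀ {u d} → IsEdge R u d → IsEdge R (step u d) (opp d)
  edge-opp {u} {d} (inj₁ l∈) = inj₂ (subst (_∈ squares R) (sym (right-step-opp u d)) l∈)
  edge-opp {u} {d} (inj₂ r∈) = inj₁ (subst (_∈ squares R) (sym (left-step-opp u d)) r∈)

  edge-opp⁻¹ : ∀ {u d} → IsEdge R (step u d) (opp d) → IsEdge R u d
  edge-opp⁻¹ {u} {d} (inj₁ l∈) = inj₂ (subst (_∈ squares R) (left-step-opp u d) l∈)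
  edge-opp⁻¹ {u} {d} (inj₂ r∈) = inj₁ (subst (_∈ squares R) (right-step-opp u d) r∈)

  boundary-opp : ∀ {u d} → IsBoundaryEdge R u d → IsBoundaryEdge R (step u d) (opp d)
  boundary-opp {u} {d} b = subst₂
    (λ l r → (l ∈ squares R × ¬ r ∈ squares R) ⊎ (¬ l ∈ squares R × r ∈ squares R))
    (sym (left-step-opp u d)) (sym (right-step-opp u d))
    ([ (λ (l , r) → inj₂ (r , l)) , (λ (l , r) → inj₁ (r , l)) ]′ b)

  -- Crossing an edge at an interior vertex never leaves `R`, so one square at `v` yields the other
  -- three in clockwise order.
  interior⇒square : ∀ {v} → IsVertex R v → ¬ OnBoundary R v → ∀ d → left v d ∈ squares R
  interior⇒square {v} iv ¬b = λ where
      E → east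
      N → north
      W → west
      S → across E east
    where
    across : ∀ d → left v d ∈ squares R → right v d ∈ squares R
    across d l∈ with right v d ∈? squares R
    ... | yes r∈ = r∈
    ... | no r∉  = ⊥-elim (¬b (d , inj₁ (l∈ , r∉)))

    west  = interior⇒westEdge R iv ¬b
    north = across W west
    east  = across N north

  interior⇒edge : ∀ {v} → IsVertex R v → ¬ OnBoundary R v → ∀ d → IsEdge R v d
  interior⇒edge iv ¬b d = inj₁ (interior⇒square iv ¬b d)

-- Walks to the boundary in the sup norm

-- The Boolean names an axis in the same way as `vertical`: a step in direction `d` changes exactly
-- the coordinate `vertical d`.
coord : Bool → Vertex → ℤ
coord false = proj₁
coord true  = proj₂

dist : Bool → Vertex → Vertex → ℕ
dist c u v = ∣ coord c u ℤ.- coord c v ∣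

supDist-≤ : ∀ {u v n} → (∀ c → dist c u v ℕ.≤ n) → supDist u v ℕ.≤ n
supDist-≤ d≤n = ℕ.⊔-lub (d≤n false) (d≤n true)

dist≤supDist : ∀ c u v → dist c u v ℕ.≤ supDist u v
dist≤supDist false u v = ℕ.m≤m⊔n _ _
dist≤supDist true  u v = ℕ.m≤n⊔m (dist false u v) _

dist-sym : ∀ c u v → dist c u v ≡ dist c v u
dist-sym c u v = ℤ.∣i-j∣≡∣j-i∣ (coord c u) (coord c v)

supDist-sym : ∀ u v → supDist u v ≡ supDist v u
supDist-sym u v = cong₂ ℕ._⊔_ (dist-sym false u v) (dist-sym true u v)

dist-triangle : ∀ c u v w → dist c u w ℕ.≤ dist c u v ℕ.+ dist c v w
dist-triangle c u v w = subst (λ i → ∣ i ∣ ℕ.≤ dist c u v ℕ.+ dist c v w)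
  (telescope (coord c u) (coord c v) (coord c w))
  (ℤ.∣i+j∣≤∣i∣+∣j∣ (coord c u ℤ.- coord c v) (coord c v ℤ.- coord c w))
  where
  telescope : ∀ i j k → (i ℤ.- j) ℤ.+ (j ℤ.- k) ≡ i ℤ.- k
  telescope = solve-∀

supDist-triangle : ∀ u v w → supDist u w ℕ.≤ supDist u v ℕ.+ supDist v w
supDist-triangle u v w = supDist-≤ λ c → ℕ.≤-trans (dist-triangle c u v w)
  (ℕ.+-mono-≤ (dist≤supDist c u v) (dist≤supDist c v w))

dist-refl : ∀ c u → dist c u u ≡ 0
dist-refl c u = cong ∣_∣ (ℤ.+-inverseʳ (coord c u))

supDist-refl : ∀ u → supDist u u ≡ 0
supDist-refl u = cong₂ ℕ._⊔_ (dist-refl false u) (dist-refl true u)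

dist-0 : ∀ u v → (∀ c → dist c u v ≡ 0) → u ≡ v
dist-0 u v d≡0 = cong₂ _,_ (ℤ.i-j≡0⇒i≡j _ _ (ℤ.∣i∣≡0⇒i≡0 (d≡0 false)))
                           (ℤ.i-j≡0⇒i≡j _ _ (ℤ.∣i∣≡0⇒i≡0 (d≡0 true)))

coord-step-other : ∀ u d → coord (not (vertical d)) (step u d) ≡ coord (not (vertical d)) u
coord-step-other u E = refl
coord-step-other u N = refl
coord-step-other u W = refl
coord-step-other u S = refl

dist-step : ∀ u d → dist (vertical d) u (step u d) ≡ 1
dist-step u E = cong ∣_∣ (eq (proj₁ u))
  where
  eq : ∀ i → i ℤ.- (+ 1 ℤ.+ i) ≡ -[1+ 0 ]
  eq = solve-∀
dist-step u N = cong ∣_∣ (eq (proj₂ u))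
  where
  eq : ∀ i → i ℤ.- (+ 1 ℤ.+ i) ≡ -[1+ 0 ]
  eq = solve-∀
dist-step u W = cong ∣_∣ (eq (proj₁ u))
  where
  eq : ∀ i → i ℤ.- (-[1+ 0 ] ℤ.+ i) ≡ + 1
  eq = solve-∀
dist-step u S = cong ∣_∣ (eq (proj₂ u))
  where
  eq : ∀ i → i ℤ.- (-[1+ 0 ] ℤ.+ i) ≡ + 1
  eq = solve-∀

dist-step-other : ∀ u d v → dist (not (vertical d)) (step u d) v ≡ dist (not (vertical d)) u v
dist-step-other u d v = cong (λ i → ∣ i ℤ.- coord (not (vertical d)) v ∣) (coord-step-other u d)

dist-own-other : ∀ u d → dist (not (vertical d)) u (step u d) ≡ 0
dist-own-other u d = trans (dist-sym (not (vertical d)) u (step u d))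
  (trans (dist-step-other u d u) (dist-refl (not (vertical d)) u))

along : (P : Bool → Set) (b : Bool) → P b → P (not b) → ∀ c → P c
along P false p q false = p
along P false p q true  = q
along P true  p q false = q
along P true  p q true  = p

supDist-step : ∀ u d → supDist u (step u d) ℕ.≤ 1
supDist-step u d = supDist-≤ (along (λ c → dist c u (step u d) ℕ.≤ 1) (vertical d)
  (ℕ.≤-reflexive (dist-step u d)) (subst (ℕ._≤ 1) (sym (dist-own-other u d)) z≤n))

-- Two perpendicular steps change each coordinate by one. This is where the sup norm enters: a
-- zigzag of two edges uses up a single unit of distance.
supDist-diagonal : ∀ u d e → vertical e ≡ not (vertical d) →
  supDist u (step (step u d) e) ℕ.≤ 1
supDist-diagonal u d e e⊥d = supDist-≤ (along (λ c → dist c u w ℕ.≤ 1) (vertical d)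
    (via (vertical d) (ℕ.≤-reflexive (dist-step u d))
      (ℕ.≤-reflexive (subst (λ c → dist c v w ≡ 0) ¬e≡d (dist-own-other v e))))
    (ℕ.≤-trans (dist-triangle (not (vertical d)) u v w)
      (ℕ.+-mono-≤ {_} {0} {_} {1} (ℕ.≤-reflexive (dist-own-other u d))
        (ℕ.≤-reflexive (subst (λ c → dist c v w ≡ 1) e⊥d (dist-step v e))))))
  where
  v w : Vertex
  v = step u d
  w = step v e
  ¬e≡d : not (vertical e) ≡ vertical d
  ¬e≡d = trans (cong not e⊥d) (Bool.not-involutive (vertical d))
  via : ∀ c → dist c u v ℕ.≤ 1 → dist c v w ℕ.≤ 0 → dist c u w ℕ.≤ 1
  via c p q = ℕ.≤-trans (dist-triangle c u v w) (ℕ.+-mono-≤ p q)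

∣∣-decrease : ∀ z {k} → ∣ z ∣ ≡ suc k → ∣ ℤ.suc z ∣ ≡ k ⊎ ∣ ℤ.pred z ∣ ≡ k
∣∣-decrease (+ suc n)      refl = inj₂ refl
∣∣-decrease -[1+ zero ]    refl = inj₁ refl
∣∣-decrease -[1+ suc n ]   refl = inj₁ refl

approach : ∀ c u v {k} → dist c u v ≡ suc k →
  ∃ λ d → vertical d ≡ c × dist c (step u d) v ≡ k
approach c u v eq with ∣∣-decrease (coord c u ℤ.- coord c v) eq
approach false u v eq | inj₁ p =
  E , refl , trans (cong ∣_∣ (ℤ.+-assoc (+ 1) (proj₁ u) (ℤ.- proj₁ v))) p
approach false u v eq | inj₂ p =
  W , refl , trans (cong ∣_∣ (ℤ.+-assoc -[1+ 0 ] (proj₁ u) (ℤ.- proj₁ v))) p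
approach true  u v eq | inj₁ p =
  N , refl , trans (cong ∣_∣ (ℤ.+-assoc (+ 1) (proj₂ u) (ℤ.- proj₂ v))) p
approach true  u v eq | inj₂ p =
  S , refl , trans (cong ∣_∣ (ℤ.+-assoc -[1+ 0 ] (proj₂ u) (ℤ.- proj₂ v))) p

-- The height changes by 1 or -3 along an edge with black on its left, and by -1 or 3 with white.
-- The lower value is recorded; the other is 4 more.
lowest : Bool → ℤ
lowest true  = ℤ.- + 3
lowest false = ℤ.- + 1

low : Vertex → Dir → ℤ
low u d = lowest (black (left u d))

-- The cheap edges are those with a black square on the left for a height function h,
-- and those with a white square on the left for − h.
record Climb (R : Region) (κ : Bool) (g : Heights) : Set where
  field
    cheap : ∀ u d → IsEdge R u d → black (left u d) ≡ κ → g (step u d) ℤ.≤ g u ℤ.+ + 1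
    any   : ∀ u d → IsEdge R u d → g (step u d) ℤ.≤ g u ℤ.+ + 3

module _ {R : Region} {h : Heights} (H : IsHeight R h) where

  edge-range : ∀ u d → IsEdge R u d →
    h u ℤ.+ low u d ℤ.≤ h (step u d) × h (step u d) ℤ.≤ h u ℤ.+ (low u d ℤ.+ + 4)
  edge-range u d e with black (left u d) in eq
  ... | true  = [ (λ p → subst Within (sym p) (up ℤ.-≤+ , up ℤ.≤-refl))
                , (λ p → subst Within (sym p) (up ℤ.≤-refl , up ℤ.-≤+)) ]′
                (IsHeight.black H u d e (black-sound (left u d) eq))
    where
    Within : ℤ → Set
    Within i = h u ℤ.+ ℤ.- + 3 ℤ.≤ i × i ℤ.≤ h u ℤ.+ + 1
    up : ∀ {i j} → i ℤ.≤ j → h u ℤ.+ i ℤ.≤ h u ℤ.+ j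
    up = ℤ.+-monoʳ-≤ (h u)
  -- The reversed edge has the black square on its left, and its height condition is solved for the
  -- height at `step u d`.
  ... | false = [ (λ p → subst Within (back 1+ p) (up ℤ.≤-refl , up ℤ.-≤+))
                , (λ p → subst Within (back 3- p) (up ℤ.-≤+ , up ℤ.≤-refl)) ]′
                (subst (λ w → h w ≡ h v ℤ.+ + 1 ⊎ h w ≡ h v ℤ.- + 3) (step-opp u d)
                  (IsHeight.black H v (opp d) (edge-opp R {u} {d} e)
                    (black-sound (left v (opp d)) left-black)))
    where
    v : Vertex
    v = step u d
    left-black : black (left v (opp d)) ≡ true
    left-black = trans (cong black (left-step-opp u d)) (trans (black-right u d) (cong not eq))
    Within : ℤ → Set
    Within i = h u ℤ.+ ℤ.- + 1 ℤ.≤ i × i ℤ.≤ h u ℤ.+ + 3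
    up : ∀ {i j} → i ℤ.≤ j → h u ℤ.+ i ℤ.≤ h u ℤ.+ j
    up = ℤ.+-monoʳ-≤ (h u)
    back : ∀ {i j k} → (∀ x → (x ℤ.+ j) ℤ.+ k ≡ x) → i ≡ h v ℤ.+ j → i ℤ.+ k ≡ h v
    back identity refl = identity (h v)
    1+ : ∀ x → (x ℤ.+ + 1) ℤ.+ ℤ.- + 1 ≡ x
    1+ = solve-∀
    3- : ∀ x → (x ℤ.+ ℤ.- + 3) ℤ.+ + 3 ≡ x
    3- = solve-∀

  height-climb : Climb R true h
  height-climb = record
    { cheap = λ u d e eq →
        subst (λ b → h (step u d) ℤ.≤ h u ℤ.+ (lowest b ℤ.+ + 4)) eq (proj₂ (edge-range u d e))
    ; any   = λ u d e → ℤ.≤-trans (proj₂ (edge-range u d e))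
        (ℤ.+-monoʳ-≤ (h u) (low+4≤3 (black (left u d))))
    }
    where
    low+4≤3 : ∀ b → lowest b ℤ.+ + 4 ℤ.≤ + 3
    low+4≤3 true  = ℤ.+≤+ (s≤s z≤n)
    low+4≤3 false = ℤ.≤-refl

  -- With white on the left, `- h` changes by 1 or -3. Through the change of sign the same walks
  -- also bound heights from below.
  depth-climb : Climb R false (ℤ.-_ ∘ h)
  depth-climb = record
    { cheap = λ u d e eq → negated (h u) (+ 1)
        (subst (λ b → h u ℤ.+ lowest b ℤ.≤ h (step u d)) eq (proj₁ (edge-range u d e)))
    ; any   = λ u d e → negated (h u) (+ 3)
        (ℤ.≤-trans (ℤ.+-monoʳ-≤ (h u) (-3≤low (black (left u d)))) (proj₁ (edge-range u d e)))
    }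
    where
    -3≤low : ∀ b → ℤ.- + 3 ℤ.≤ lowest b
    -3≤low true  = ℤ.≤-refl
    -3≤low false = ℤ.-≤- z≤n
    negated : ∀ i {j} k → i ℤ.+ ℤ.- k ℤ.≤ j → ℤ.- j ℤ.≤ ℤ.- i ℤ.+ k
    negated i {j} k p = ≤-shift p (identity i j k)
      where
      identity : ∀ i j k → ℤ.- j ℤ.+ j ≡ ℤ.- i ℤ.+ k ℤ.+ (i ℤ.+ ℤ.- k)
      identity = solve-∀

module _ {R : Region} {κ : Bool} {g : Heights} (climb : Climb R κ g) where
  open Climb climb

  -- The vertex `x` need not be the target of the walk, which stops as soon as it meets the
  -- boundary; what counts is its distance from `u` and the climb up to it.
  NearBoundary : Vertex → ℕ → ℕ → Set
  NearBoundary u n m = ∃ λ x → OnBoundary R x × supDist u x ℕ.≤ n × g x ℤ.≤ g u ℤ.+ + m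

  stop : ∀ {u n m} → OnBoundary R u → NearBoundary u n m
  stop {u} {n} {m} b = u , b , ℕ.≤-trans (ℕ.≤-reflexive (supDist-refl u)) z≤n ,
    subst (ℤ._≤ g u ℤ.+ + m) (ℤ.+-identityʳ (g u)) (ℤ.+-monoʳ-≤ (g u) (ℤ.+≤+ z≤n))

  onward : ∀ {u v k n l m} → supDist u v ℕ.≤ k → g v ℤ.≤ g u ℤ.+ + l →
    NearBoundary v n m → NearBoundary u (k ℕ.+ n) (l ℕ.+ m)
  onward {u} {v} {k} {n} {l} {m} uv gv (x , b , vx , gx) =
    x , b , ℕ.≤-trans (supDist-triangle u v x) (ℕ.+-mono-≤ uv vx) ,
    subst (g x ℤ.≤_) (ℤ.+-assoc (g u) (+ l) (+ m)) (ℤ.≤-trans gx (ℤ.+-monoˡ-≤ (+ m) gv))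

  widen : ∀ {u n n′ m m′} → n ℕ.≤ n′ → m ℕ.≤ m′ → NearBoundary u n m → NearBoundary u n′ m′
  widen {u} n≤ m≤ (x , b , ux , gx) =
    x , b , ℕ.≤-trans ux n≤ , ℤ.≤-trans gx (ℤ.+-monoʳ-≤ (g u) (ℤ.+≤+ m≤))

  black-left-repeat : ∀ u d e → vertical e ≡ vertical d →
    black (left (step u d) e) ≡ not (black (left u d))
  black-left-repeat u d e e∥d = trans (black-left-step u d e)
    (cong not (trans (cong (_xor black u) e∥d) (sym (black-left u d))))

  -- Moving to a neighbouring vertex flips the colour, and so does changing the axis; the two flips
  -- cancel.
  black-left-turn : ∀ u d e → vertical e ≡ not (vertical d) →
    black (left (step u d) e) ≡ black (left u d)
  black-left-turn u d e e⊥d = trans (black-left-step u d e)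
    (trans (cong (λ b → not (b xor black u)) e⊥d)
    (trans (not-xor (vertical d) (black u)) (sym (black-left u d))))
    where
    not-xor : ∀ a b → not (not a xor b) ≡ a xor b
    not-xor false b = Bool.not-involutive b
    not-xor true  b = refl

  climb-via : ∀ {u v w i j} → g v ℤ.≤ g u ℤ.+ i → g w ℤ.≤ g v ℤ.+ j → g w ℤ.≤ g u ℤ.+ (i ℤ.+ j)
  climb-via {u} {v} {w} {i} {j} p q =
    subst (g w ℤ.≤_) (ℤ.+-assoc (g u) i j) (ℤ.≤-trans q (ℤ.+-monoˡ-≤ j p))

  -- One of the two edges is cheap and climbs at most 1, the other at most 3, in either order.
  climb-straight : ∀ {u d e} → IsEdge R u d → IsEdge R (step u d) e → vertical e ≡ vertical d →
    g (step (step u d) e) ℤ.≤ g u ℤ.+ + 4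
  climb-straight {u} {d} {e} ud ve e∥d with black (left u d) Bool.≟ κ
  ... | yes eq = climb-via {u} {step u d} (cheap u d ud eq) (any (step u d) e ve)
  ... | no neq = climb-via {u} {step u d} (any u d ud) (cheap (step u d) e ve
          (trans (black-left-repeat u d e e∥d)
                 (sym (Bool.¬-not (neq ∘ sym)))))

  climb-diagonal : ∀ {u d e} → IsEdge R u d → IsEdge R (step u d) e → vertical e ≡ not (vertical d) →
    black (left u d) ≡ κ → g (step (step u d) e) ℤ.≤ g u ℤ.+ + 2
  climb-diagonal {u} {d} {e} ud ve e⊥d eq = climb-via {u} {step u d} (cheap u d ud eq)
    (cheap (step u d) e ve (trans (black-left-turn u d e e⊥d) eq))

  -- A single edge may climb 3, which is exactly the allowance `2 * 1 + 1` for distance 1.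
  stop-after : ∀ {u d n} → IsEdge R u d → OnBoundary R (step u d) →
    NearBoundary u (suc n) (2 ℕ.* suc n ℕ.+ 1)
  stop-after {u} {d} {n} ud b = widen (s≤s z≤n)
    (ℕ.+-monoˡ-≤ 1 (ℕ.*-monoʳ-≤ 2 (s≤s (z≤n {n}))))
    (onward {u} {step u d} {1} {0} {3} {0} (supDist-step u d) (any u d ud) (stop b))

  -- Cheap edges alternate with dear ones along a straight line, whereas a diagonal
  -- zigzag starting in the right direction uses cheap edges only.
  near-boundary : ∀ n u t → (∀ c → dist c u t ℕ.≤ n) → IsVertex R u → OnBoundary R t →
    NearBoundary u n (2 ℕ.* n ℕ.+ 1)
  straight : ∀ n u t c {k} → dist c u t ≡ suc k → dist (not c) u t ≡ 0 → suc k ℕ.≤ n →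
    IsVertex R u → ¬ OnBoundary R u → OnBoundary R t → NearBoundary u n (2 ℕ.* n ℕ.+ 1)
  straight₂ : ∀ n u d t {k} → dist (vertical d) (step u d) t ≡ k → dist (not (vertical d)) u t ≡ 0 →
    k ℕ.≤ n → IsEdge R u d → ¬ OnBoundary R (step u d) → OnBoundary R t →
    NearBoundary u (suc n) (2 ℕ.* suc n ℕ.+ 1)
  diagonal : ∀ n u t c {k l} → dist c u t ≡ suc k → dist (not c) u t ≡ suc l →
    suc k ℕ.≤ n → suc l ℕ.≤ n → c xor black u ≡ κ →
    IsVertex R u → ¬ OnBoundary R u → OnBoundary R t → NearBoundary u n (2 ℕ.* n ℕ.+ 1)

  near-boundary n u t ut iu bt with onBoundary? R u
  ... | yes b = stop b
  ... | no ¬b = cases _ _ refl refl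
    where
    ut′ : ∀ c {k} → dist c u t ≡ k → k ℕ.≤ n
    ut′ c eq = subst (ℕ._≤ n) eq (ut c)

    cases : ∀ k l → dist false u t ≡ k → dist true u t ≡ l → NearBoundary u n (2 ℕ.* n ℕ.+ 1)
    cases zero    zero    p q = ⊥-elim (¬b (subst (OnBoundary R)
      (sym (dist-0 u t (along (λ c → dist c u t ≡ 0) false p q))) bt))
    cases (suc k) zero    p q = straight n u t false p q (ut′ false p) iu ¬b bt
    cases zero    (suc l) p q = straight n u t true q p (ut′ true q) iu ¬b bt
    -- Horizontal and vertical edges at `u` have opposite colours on their left, so the axis of the
    -- first step can be chosen to make it cheap.
    cases (suc k) (suc l) p q with black u Bool.≟ κ
    ... | yes eq = diagonal n u t false p q (ut′ false p) (ut′ true q) eq iu ¬b bt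
    ... | no neq = diagonal n u t true q p (ut′ true q) (ut′ false p)
                     (sym (Bool.¬-not (neq ∘ sym))) iu ¬b bt

  straight (suc n) u t c p q (s≤s k≤n) iu ¬b bt
    with d , refl , p′ ← approach c u t p
    with onBoundary? R (step u d)
  ... | yes b  = stop-after (interior⇒edge R iu ¬b d) b
  ... | no ¬b′ = straight₂ n u d t p′ q k≤n (interior⇒edge R iu ¬b d) ¬b′ bt

  straight₂ n u d t {zero} p q k≤n ud ¬b bt = ⊥-elim (¬b (subst (OnBoundary R)
    (sym (dist-0 (step u d) t (along (λ c → dist c (step u d) t ≡ 0) (vertical d) p
      (trans (dist-step-other u d t) q)))) bt))
  straight₂ (suc n) u d t {suc k} p q (s≤s k≤n) ud ¬b bt
    with e , e∥d , p′ ← approach (vertical d) (step u d) t p =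
    -- Two straight steps use up two units of distance and climb at most 4.
    widen ℕ.≤-refl (ℕ.≤-reflexive (arith n))
      (onward {u} {w} {2} {n} {4} (ℕ.≤-trans (supDist-triangle u v w)
          (ℕ.+-mono-≤ (supDist-step u d) (supDist-step v e)))
        (climb-straight ud ve e∥d)
        (near-boundary n w t (along (λ c → dist c w t ℕ.≤ n) (vertical d)
            (subst (ℕ._≤ n) (sym p′) k≤n)
            (subst (ℕ._≤ n) (sym w-aligned) z≤n))
          (edge-target R {v} {e} ve) bt))
    where
    v w : Vertex
    v = step u d
    w = step v e
    ve : IsEdge R v e
    ve = interior⇒edge R (edge-target R {u} {d} ud) ¬b e
    w-aligned : dist (not (vertical d)) w t ≡ 0
    w-aligned = trans (subst (λ c → dist (not c) w t ≡ dist (not c) v t) e∥d (dist-step-other v e t))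
                      (trans (dist-step-other u d t) q)
    arith : ∀ n → 4 ℕ.+ (2 ℕ.* n ℕ.+ 1) ≡ 2 ℕ.* suc (suc n) ℕ.+ 1
    arith n = cong (ℕ._+ 1) (sym (ℕ.*-distribˡ-+ 2 2 n))

  diagonal (suc n) u t c p q (s≤s k≤n) (s≤s l≤n) eq iu ¬b bt
    with d , refl , p′ ← approach c u t p
    with onBoundary? R (step u d)
  ... | yes b  = stop-after (interior⇒edge R iu ¬b d) b
  ... | no ¬b′
    with e , e⊥d , q′ ← approach (not (vertical d)) (step u d) t (trans (dist-step-other u d t) q) =
    -- Two cheap steps use up one unit of sup-norm distance and climb at most 2.
    widen ℕ.≤-refl (ℕ.≤-reflexive (arith n))
      (onward {u} {w} {1} {n} {2} (supDist-diagonal u d e e⊥d)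
        (climb-diagonal ud ve e⊥d (trans (black-left u d) eq))
        (near-boundary n w t (along (λ c → dist c w t ℕ.≤ n) (vertical d)
            (subst (ℕ._≤ n) (sym w-kept) k≤n)
            (subst (ℕ._≤ n) (sym q′) l≤n))
          (edge-target R {v} {e} ve) bt))
    where
    v w : Vertex
    v = step u d
    w = step v e
    ud : IsEdge R u d
    ud = interior⇒edge R iu ¬b d
    ve : IsEdge R v e
    ve = interior⇒edge R (edge-target R {u} {d} ud) ¬b′ e
    ¬e≡d : not (vertical e) ≡ vertical d
    ¬e≡d = trans (cong not e⊥d) (Bool.not-involutive (vertical d))
    w-kept : dist (vertical d) w t ≡ _
    w-kept = trans (subst (λ c → dist c w t ≡ dist c v t) ¬e≡d (dist-step-other v e t)) p′
    arith : ∀ n → 2 ℕ.+ (2 ℕ.* n ℕ.+ 1) ≡ 2 ℕ.* suc n ℕ.+ 1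
    arith n = cong (ℕ._+ 1) (sym (ℕ.*-distribˡ-+ 2 1 n))

-- Exchanging clusters

isVertex? : ∀ R v → Dec (IsVertex R v)
isVertex? R v = ∃dir? R (λ d → left v d ∈? squares R)

≈-setoid : Region → Setoid 0ℓ 0ℓ
≈-setoid R = record
  { Carrier       = Heights
  ; _≈_           = _≈_ R
  ; isEquivalence = record
    { refl  = λ _ _ → refl
    ; sym   = λ g≈h v iv → sym (g≈h v iv)
    ; trans = λ f≈g g≈h v iv → trans (f≈g v iv) (g≈h v iv)
    }
  }

-- Height conditions concern one edge at a time and are invariant under adding a constant, so it
-- suffices that on each edge `k` coincides with one height function or with a translate of another.
extends-patch : ∀ {R R′ f h h′ k} e → Extends R f h → IsHeight R′ h′ →
  (∀ u d → IsEdge R u d →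
    (k u ≡ h u × k (step u d) ≡ h (step u d)) ⊎
    (IsEdge R′ u d × k u ≡ h′ u ℤ.+ e × k (step u d) ≡ h′ (step u d) ℤ.+ e)) →
  (∀ w → OnBoundary R w → k w ≡ h w) → Extends R f k
extends-patch {R} {R′} {f} {h} {h′} {k} e ext H′ patch unchanged = record
  { isHeight = record
    { boundary = λ u d b → trans
        (cong₂ (λ i j → ∣ i ℤ.- j ∣) (unchanged (step u d) (opp d , boundary-opp R {u} {d} b))
                                    (unchanged u (d , b)))
        (IsHeight.boundary isHeight u d b)
    ; black    = black′
    }
  ; agrees   = λ w b → trans (unchanged w b) (agrees w b)
  }
  where
  open Extends ext

  Increment : ℤ → ℤ → Set
  Increment i j = j ≡ i ℤ.+ + 1 ⊎ j ≡ i ℤ.- + 3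

  shifted : ∀ i j → Increment i j → Increment (i ℤ.+ e) (j ℤ.+ e)
  shifted i _ (inj₁ refl) = inj₁ (commute i e)
    where
    commute : ∀ i e → i ℤ.+ + 1 ℤ.+ e ≡ i ℤ.+ e ℤ.+ + 1
    commute = solve-∀
  shifted i _ (inj₂ refl) = inj₂ (commute i e)
    where
    commute : ∀ i e → i ℤ.- + 3 ℤ.+ e ≡ i ℤ.+ e ℤ.- + 3
    commute = solve-∀

  black′ : ∀ u d → IsEdge R u d → Black (left u d) → Increment (k u) (k (step u d))
  black′ u d ud bl with patch u d ud
  ... | inj₁ (p , q) = subst₂ Increment (sym p) (sym q) (IsHeight.black isHeight u d ud bl)
  ... | inj₂ (ud′ , p , q) = subst₂ Increment (sym p) (sym q)
          (shifted (h′ u) (h′ (step u d)) (IsHeight.black H′ u d ud′ bl))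

i<j⇒0<j-i : ∀ {i j} → i ℤ.< j → 0ℤ ℤ.< j ℤ.- i
i<j⇒0<j-i {i} {j} i<j = subst (ℤ._< j ℤ.- i) (ℤ.+-inverseʳ i) (ℤ.+-monoˡ-< (ℤ.- i) i<j)

0<j-i⇒i<j : ∀ {i j} → 0ℤ ℤ.< j ℤ.- i → i ℤ.< j
0<j-i⇒i<j {i} {j} 0<j-i =
  subst₂ ℤ._<_ (ℤ.+-identityˡ i) (cancel j i) (ℤ.+-monoˡ-< i 0<j-i)
  where
  cancel : ∀ j i → j ℤ.- i ℤ.+ i ≡ j
  cancel = solve-∀

multiple-≥ : ∀ {n z} → + n ∣ z → 0ℤ ℤ.< z → + n ℤ.≤ z
multiple-≥ {z = + suc m} n∣z _ = ℤ.+≤+ (ℕ.∣⇒≤ n∣z)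
multiple-≥ {z = + zero} n∣z (ℤ.+<+ ())

Common : Region → Region → Vertex → Set
Common R₁ R₂ w = IsVertex R₁ w × IsVertex R₂ w

module ClusterSwap (R₁ R₂ : Region) (D : ℤ) (v : Vertex) where

  Pair : Set
  Pair = Heights × Heights

  Meet Differ : Pair → Vertex → Set
  Meet (a , b) w = a w ≡ b w ℤ.+ D
  Differ p w = Common R₁ R₂ w × ¬ Meet p w

  Joined : Pair → Vertex → Vertex → Set
  Joined p u w = (∃ λ d → step u d ≡ w) × Differ p u × Differ p w

  -- All vertices where `Differ` holds belong to `R₁`, so its vertices are the only intermediate
  -- points that a path can need.
  Cluster : Pair → Vertex → Set
  Cluster p = Reachable (Joined p) (vertices R₁) v

  cluster? : ∀ p w → Dec (Cluster p w)
  cluster? p@(a , b) = reachable? (Joined p) _≟_ joined? (vertices R₁) v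
    where
    differ? : ∀ w → Dec (Differ p w)
    differ? w = (isVertex? R₁ w ×-dec isVertex? R₂ w) ×-dec ¬? (a w ℤ.≟ b w ℤ.+ D)

    joined? : ∀ u w → Dec (Joined p u w)
    joined? u w = ∃dir? R₁ (λ d → step u d ≟ w) ×-dec differ? u ×-dec differ? w

  swap : Pair → Pair
  swap p@(a , b) = (λ w → if does (cluster? p w) then b w ℤ.+ D else a w)
                 , (λ w → if does (cluster? p w) then a w ℤ.- D else b w)

  Swapped Kept : Pair → Vertex → Set
  Swapped p@(a , b) w = proj₁ (swap p) w ≡ b w ℤ.+ D × proj₂ (swap p) w ≡ a w ℤ.- D
  Kept    p@(a , b) w = proj₁ (swap p) w ≡ a w × proj₂ (swap p) w ≡ b w

  swap-inside : ∀ p w → Cluster p w → Swapped p w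
  swap-inside p w c rewrite dec-true (cluster? p w) c = refl , refl

  swap-outside : ∀ p w → ¬ Cluster p w → Kept p w
  swap-outside p w ¬c rewrite dec-false (cluster? p w) ¬c = refl , refl

  i-D+D : ∀ i D → i ℤ.- D ℤ.+ D ≡ i
  i-D+D = solve-∀

  i+D-D : ∀ i D → i ℤ.+ D ℤ.- D ≡ i
  i+D-D = solve-∀

  module _ (p : Pair) where

    -- Exchanging `a w` with `b w + D` does not affect whether they are equal. Hence the exchange
    -- preserves the cluster and undoes itself when repeated.
    meet-swap : ∀ w → (Meet p w → Meet (swap p) w) × (Meet (swap p) w → Meet p w)
    meet-swap w with cluster? p w
    ... | yes _ = (λ eq → trans (sym eq) (sym (i-D+D _ D)))
                , (λ eq → sym (trans eq (i-D+D _ D)))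
    ... | no _  = id , id

    cluster-swap : ∀ {w} → Cluster p w → Cluster (swap p) w
    cluster-swap = reachable-map
      (λ { (adj , (cu , u≢) , (cw , w≢)) →
           adj , (cu , u≢ ∘ proj₂ (meet-swap _)) , (cw , w≢ ∘ proj₂ (meet-swap _)) }) (vertices R₁)

    cluster-swap⁻¹ : ∀ {w} → Cluster (swap p) w → Cluster p w
    cluster-swap⁻¹ = reachable-map
      (λ { (adj , (cu , u≢) , (cw , w≢)) →
           adj , (cu , u≢ ∘ proj₁ (meet-swap _)) , (cw , w≢ ∘ proj₁ (meet-swap _)) }) (vertices R₁)

    swap-involutive : ∀ w →
      proj₁ (swap (swap p)) w ≡ proj₁ p w × proj₂ (swap (swap p)) w ≡ proj₂ p w
    swap-involutive w = case (cluster? p w)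
      where
      case : Dec (Cluster p w) → _
      case (yes c) = let (s₁ , s₂) = swap-inside p w c
                         (t₁ , t₂) = swap-inside (swap p) w (cluster-swap c) in
        trans t₁ (trans (cong (ℤ._+ D) s₂) (i-D+D _ D)) ,
        trans t₂ (trans (cong (ℤ._- D) s₁) (i+D-D _ D))
      case (no ¬c) = let (s₁ , s₂) = swap-outside p w ¬c
                         (t₁ , t₂) = swap-outside (swap p) w (¬c ∘ cluster-swap⁻¹) in
        trans t₁ s₁ , trans t₂ s₂

  -- Values away from the regions are ignored, as in the enumerations, whose entries are complete
  -- and distinct only in this sense.
  _≋_ : Pair → Pair → Set
  (a , b) ≋ (a′ , b′) = _≈_ R₁ a a′ × _≈_ R₂ b b′

  ≋-sym : ∀ {p q} → p ≋ q → q ≋ p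
  ≋-sym (α , β) = (λ w iw → sym (α w iw)) , (λ w iw → sym (β w iw))

  ≋-trans : ∀ {p q r} → p ≋ q → q ≋ r → p ≋ r
  ≋-trans (α , β) (α′ , β′) =
    (λ w iw → trans (α w iw) (α′ w iw)) , (λ w iw → trans (β w iw) (β′ w iw))

  swap²-≋ : ∀ p → swap (swap p) ≋ p
  swap²-≋ p = (λ w _ → proj₁ (swap-involutive p w)) , (λ w _ → proj₂ (swap-involutive p w))

  cluster-resp : ∀ {p q} → p ≋ q → ∀ {w} → Cluster p w → Cluster q w
  cluster-resp {p} {q} (α , β) = reachable-map
      (λ { (adj , du , dw) → adj , differ-resp du , differ-resp dw }) (vertices R₁)
    where
    differ-resp : ∀ {w} → Differ p w → Differ q w
    differ-resp {w} ((i₁ , i₂) , p≢) =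
      (i₁ , i₂) , λ eq → p≢ (trans (α w i₁) (trans eq (cong (ℤ._+ D) (sym (β w i₂)))))

  module _ (v∈₁ : IsVertex R₁ v) (v∈₂ : IsVertex R₂ v) where

    cluster-common : ∀ p {w} → Cluster p w → Common R₁ R₂ w
    cluster-common p c = reachable-invariant (Joined p) (Common R₁ R₂)
      (λ { (_ , _ , (cw , _)) _ → cw }) (vertices R₁) c (v∈₁ , v∈₂)

    -- Inside the cluster each function takes its value from the other one, so equality there relies
    -- on the cluster lying in both regions.
    swap-resp : ∀ {p q} → p ≋ q → swap p ≋ swap q
    swap-resp {p} {q} p≋q@(α , β) = (λ w → first w (cluster? p w)) , (λ w → second w (cluster? p w))
      where
      first : ∀ w → Dec (Cluster p w) → IsVertex R₁ w → proj₁ (swap p) w ≡ proj₁ (swap q) w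
      first w (yes c) i = trans (proj₁ (swap-inside p w c))
        (trans (cong (ℤ._+ D) (β w (proj₂ (cluster-common p c))))
               (sym (proj₁ (swap-inside q w (cluster-resp p≋q c)))))
      first w (no ¬c) i = trans (proj₁ (swap-outside p w ¬c))
        (trans (α w i) (sym (proj₁ (swap-outside q w (¬c ∘ cluster-resp (≋-sym p≋q))))))

      second : ∀ w → Dec (Cluster p w) → IsVertex R₂ w → proj₂ (swap p) w ≡ proj₂ (swap q) w
      second w (yes c) i = trans (proj₂ (swap-inside p w c))
        (trans (cong (ℤ._- D) (α w (proj₁ (cluster-common p c))))
               (sym (proj₂ (swap-inside q w (cluster-resp p≋q c)))))
      second w (no ¬c) i = trans (proj₂ (swap-outside p w ¬c))
        (trans (β w i) (sym (proj₂ (swap-outside q w (¬c ∘ cluster-resp (≋-sym p≋q))))))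

    module _ {f₁ f₂ a b : Heights} (A : Extends R₁ f₁ a) (B : Extends R₂ f₂ b)
      (above⇒interior : ∀ w → Common R₁ R₂ w → b w ℤ.+ D ℤ.< a w →
        ¬ OnBoundary R₁ w × ¬ OnBoundary R₂ w)
      (congruent : ∀ w → Common R₁ R₂ w → + 4 ∣ a w ℤ.- (b w ℤ.+ D))
      (start : b v ℤ.+ D ℤ.< a v) where

      private
        p : Pair
        p = a , b

      Above : Vertex → Set
      Above w = Common R₁ R₂ w × b w ℤ.+ D ℤ.< a w

      above-edges : ∀ {u} → Above u → ∀ d → IsEdge R₁ u d × IsEdge R₂ u d
      above-edges {u} ((i₁ , i₂) , b<a) d =
        let (¬b₁ , ¬b₂) = above⇒interior u (i₁ , i₂) b<a in
        interior⇒edge R₁ i₁ ¬b₁ d , interior⇒edge R₂ i₂ ¬b₂ d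

      -- Along an edge the difference changes by 0 or ±4, so a positive multiple
      -- of 4 cannot become negative without vanishing first.
      above-step : ∀ {u w} → Joined p u w → Above u → Above w
      above-step {u} ((d , refl) , _ , (cw , differ)) above@(cu , b<a) =
        cw , ℤ.≤∧≢⇒< b≤a (differ ∘ sym)
        where
        w : Vertex
        w = step u d
        e₁ : IsEdge R₁ u d
        e₁ = proj₁ (above-edges above d)
        e₂ : IsEdge R₂ u d
        e₂ = proj₂ (above-edges above d)
        4≤ : + 4 ℤ.≤ a u ℤ.- (b u ℤ.+ D)
        4≤ = multiple-≥ (congruent u cu) (i<j⇒0<j-i b<a)
        open ℤ.≤-Reasoning
        b≤a : b w ℤ.+ D ℤ.≤ a w
        b≤a = begin
          b w ℤ.+ D
            ≤⟨ ℤ.+-monoˡ-≤ D (proj₂ (edge-range (Extends.isHeight B) u d e₂)) ⟩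
          b u ℤ.+ (low u d ℤ.+ + 4) ℤ.+ D
            ≤⟨ ≤-shift 4≤ (identity (a u) (b u) D (low u d)) ⟩
          a u ℤ.+ low u d
            ≤⟨ proj₁ (edge-range (Extends.isHeight A) u d e₁) ⟩
          a w
            ∎
          where
          identity : ∀ a b D l → b ℤ.+ (l ℤ.+ + 4) ℤ.+ D ℤ.+ (a ℤ.- (b ℤ.+ D)) ≡ a ℤ.+ l ℤ.+ + 4
          identity = solve-∀

      cluster-above : ∀ {w} → Cluster p w → Above w
      cluster-above c = reachable-invariant (Joined p) Above above-step (vertices R₁) c
        ((v∈₁ , v∈₂) , start)

      -- Neighbours of the cluster outside it satisfy a = b + D, so the exchange
      -- leaves no seam.
      swapped-neighbour : ∀ {u} → Cluster p u → ∀ d → Swapped p (step u d)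
      swapped-neighbour {u} c d with cluster? p (step u d)
      ... | yes c′ = refl , refl
      ... | no ¬c′ with a (step u d) ℤ.≟ b (step u d) ℤ.+ D
      ...   | yes eq = eq , sym (trans (cong (ℤ._- D) eq) (i+D-D (b (step u d)) D))
      ...   | no neq = ⊥-elim (¬c′ (reachable-trans (Joined p) (∈-vertices R₁ i₁) c
                (reachable-edge (Joined p) (vertices R₁)
                  ((d , refl) , ((i₁ , i₂) , differ) ,
                   ((edge-target R₁ e₁ , edge-target R₂ e₂) , neq)))))
        where
        above : Above u
        above = cluster-above c
        i₁ : IsVertex R₁ u
        i₁ = proj₁ (proj₁ above)
        i₂ : IsVertex R₂ u
        i₂ = proj₂ (proj₁ above)
        e₁ : IsEdge R₁ u d
        e₁ = proj₁ (above-edges above d)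
        e₂ : IsEdge R₂ u d
        e₂ = proj₂ (above-edges above d)
        differ : ¬ Meet p u
        differ eq = ℤ.<-irrefl (sym eq) (proj₂ above)

      -- A neighbour of the cluster counts as swapped too, so no edge has one end kept and the other
      -- swapped.
      edge-cases : ∀ u d → (Kept p u × Kept p (step u d)) ⊎
        (IsEdge R₁ u d × IsEdge R₂ u d × Swapped p u × Swapped p (step u d))
      edge-cases u d = cases (cluster? p u) (cluster? p (step u d))
        where
        cases : Dec (Cluster p u) → Dec (Cluster p (step u d)) → _
        cases (yes c) _        = let (e₁ , e₂) = above-edges (cluster-above c) d in
          inj₂ (e₁ , e₂ , swap-inside p u c , swapped-neighbour c d)
        cases (no _)  (yes c)  = let (e₁ , e₂) = above-edges (cluster-above c) (opp d) in
          inj₂ ( edge-opp⁻¹ R₁ {u} {d} e₁ , edge-opp⁻¹ R₂ {u} {d} e₂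
               , subst (Swapped p) (step-opp u d) (swapped-neighbour c (opp d))
               , swap-inside p (step u d) c)
        cases (no ¬c) (no ¬c′) = inj₁ (swap-outside p u ¬c , swap-outside p (step u d) ¬c′)

      swap-extends₁ : Extends R₁ f₁ (proj₁ (swap p))
      swap-extends₁ = extends-patch D A (Extends.isHeight B)
        (λ u d _ → Sum.map (λ (k , k′) → proj₁ k , proj₁ k′)
                           (λ (_ , e₂ , s , s′) → e₂ , proj₁ s , proj₁ s′) (edge-cases u d))
        (λ w b → proj₁ (swap-outside p w (λ c → let (cw , b<a) = cluster-above c in
          proj₁ (above⇒interior w cw b<a) b)))

      swap-extends₂ : Extends R₂ f₂ (proj₂ (swap p))
      swap-extends₂ = extends-patch (ℤ.- D) B (Extends.isHeight A)
        (λ u d _ → Sum.map (λ (k , k′) → proj₂ k , proj₂ k′)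
                           (λ (e₁ , _ , s , s′) → e₁ , proj₂ s , proj₂ s′) (edge-cases u d))
        (λ w b → proj₂ (swap-outside p w (λ c → let (cw , b<a) = cluster-above c in
          proj₂ (above⇒interior w cw b<a) b)))

-- Comparing expectations by exchanging pairs

𝔼-uniform-shifted-≤ : {A B : Set} (φ : A → ℤ) (ψ : B → ℤ) (D : ℤ) →
  ∀ xs ys {x y} → x ∈ xs → y ∈ ys →
  ∑ (cartesianProduct xs ys) (λ (a , b) → φ a ℤ.- (ψ b ℤ.+ D)) ℤ.≤ 0ℤ →
  𝔼 (uniform xs) (ι ∘ φ) ℚ.≤ 𝔼 (uniform ys) (ι ∘ ψ) ℚ.+ ι D
𝔼-uniform-shifted-≤ φ ψ D (x ∷ xs) (y ∷ ys) _ _ ∑≤0 =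
  subst (𝔼 (uniform (x ∷ xs)) (ι ∘ φ) ℚ.≤_) (𝔼-uniform-+ ψ D y ys)
    (𝔼-uniform-≤ φ (λ b → ψ b ℤ.+ D) x xs y ys ∑≤0)

module _ {R₁ R₂ : Region} {f₁ f₂ : Heights} (e₁ : Enumeration R₁ f₁) (e₂ : Enumeration R₂ f₂)
  (D : ℤ) where

  open Enumeration

  𝔼-height-≤ :
    (∀ a b → Extends R₁ f₁ a → Extends R₂ f₂ b → ∀ w → Common R₁ R₂ w → b w ℤ.+ D ℤ.< a w →
      ¬ OnBoundary R₁ w × ¬ OnBoundary R₂ w) →
    (∀ a b → Extends R₁ f₁ a → Extends R₂ f₂ b → ∀ w → Common R₁ R₂ w → + 4 ∣ a w ℤ.- (b w ℤ.+ D)) →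
    ∃ (Extends R₁ f₁) → ∃ (Extends R₂ f₂) → ∀ v → Common R₁ R₂ v →
    𝔼 (uniform (list e₁)) (λ H → ι (H v)) ℚ.≤ 𝔼 (uniform (list e₂)) (λ H → ι (H v)) ℚ.+ ι D
  𝔼-height-≤ above⇒interior congruent (h₁ , H₁) (h₂ , H₂) v (v∈₁ , v∈₂) =
    𝔼-uniform-shifted-≤ (λ a → a v) (λ b → b v) D (list e₁) (list e₂)
      (proj₁ (proj₂ (complete e₁ h₁ H₁))) (proj₁ (proj₂ (complete e₂ h₂ H₂)))
      -- The exchanged functions occur in the enumerations only up to values away from the regions,
      -- so partners are related by `≋`.
      (∑-negating _≋_ (λ p q → swap p ≋ q) cancel φ pairs
        (UniqueSetoid.cartesianProduct⁺ (≈-setoid R₁) (≈-setoid R₂) (distinct e₁) (distinct e₂))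
        partner)
    where
    open ClusterSwap R₁ R₂ D v

    pairs : List Pair
    pairs = cartesianProduct (list e₁) (list e₂)

    φ : Pair → ℤ
    φ (a , b) = a v ℤ.- (b v ℤ.+ D)

    cancel : ∀ {p p′ q} → swap p ≋ q → swap p′ ≋ q → p ≋ p′
    -- An involution compatible with `≋` is injective: `swap` is applied to `swap p ≋ swap p′`.
    cancel {p} {p′} {q} α β = ≋-trans (≋-sym (swap²-≋ p))
      (≋-trans (swap-resp v∈₁ v∈₂ (≋-trans α (≋-sym β))) (swap²-≋ p′))

    partner : ∀ p → p ∈ pairs → 0ℤ ℤ.< φ p → ∃ λ q → q ∈ pairs × swap p ≋ q × φ q ≡ ℤ.- φ p
    partner p@(a , b) p∈ φp>0
      with a∈ , b∈ ← ∈-cartesianProduct⁻ (list e₁) (list e₂) p∈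
      with A ← All.lookup (sound e₁) a∈ | B ← All.lookup (sound e₂) b∈
      with a′ , a′∈ , a′≈ ← complete e₁ (proj₁ (swap p))
             (swap-extends₁ v∈₁ v∈₂ A B (above⇒interior a b A B) (congruent a b A B)
               (0<j-i⇒i<j φp>0))
      with b′ , b′∈ , b′≈ ← complete e₂ (proj₂ (swap p))
             (swap-extends₂ v∈₁ v∈₂ A B (above⇒interior a b A B) (congruent a b A B)
               (0<j-i⇒i<j φp>0))
      = (a′ , b′) , ∈-cartesianProduct⁺ a′∈ b′∈ , ≋-sym (a′≈ , b′≈) , negated
      where
      swapped : Swapped p v
      swapped = swap-inside p v (reachable-refl (Joined p) (vertices R₁))
      negated : φ (a′ , b′) ≡ ℤ.- φ p
      negated = trans (cong₂ (λ i j → i ℤ.- (j ℤ.+ D))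
          (trans (a′≈ v v∈₁) (proj₁ swapped)) (trans (b′≈ v v∈₂) (proj₂ swapped)))
        (identity (a v) (b v) D)
        where
        identity : ∀ a b D → b ℤ.+ D ℤ.- (a ℤ.- D ℤ.+ D) ≡ ℤ.- (a ℤ.- (b ℤ.+ D))
        identity = solve-∀

-- Gaps at the boundaries, and the final estimate

i≤∣i∣ : ∀ i → i ℤ.≤ + ∣ i ∣
i≤∣i∣ (+ _)    = ℤ.≤-refl
i≤∣i∣ -[1+ _ ] = ℤ.-≤+

combined-bound : ∀ {z m n Δ₁ Δ₂} → z ℤ.≤ + m ℤ.+ + (2 ℕ.* n ℕ.+ 1) →
  ι (+ m) ℚ.≤ Δ₂ → ι (+ n) ℚ.≤ Δ₁ →
  ι z ℚ.≤ + 2 / 1 ℚ.* Δ₁ ℚ.+ Δ₂ ℚ.+ 1ℚ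
combined-bound {z} {m} {n} {Δ₁} {Δ₂} z≤ m≤ n≤ = begin
  ι z                                             ≤⟨ ι-mono-≤ z≤ ⟩
  ι (+ m ℤ.+ + (2 ℕ.* n ℕ.+ 1))                   ≡⟨ cong ι (arrange (+ m) (+ n)) ⟩
  ι (+ 2 ℤ.* + n ℤ.+ + m ℤ.+ + 1)                 ≡⟨ ι-+ (+ 2 ℤ.* + n ℤ.+ + m) (+ 1) ⟩
  ι (+ 2 ℤ.* + n ℤ.+ + m) ℚ.+ 1ℚ                  ≡⟨ cong (ℚ._+ 1ℚ) (ι-+ (+ 2 ℤ.* + n) (+ m)) ⟩
  ι (+ 2 ℤ.* + n) ℚ.+ ι (+ m) ℚ.+ 1ℚ
    ≡⟨ cong (λ r → r ℚ.+ ι (+ m) ℚ.+ 1ℚ) (ι-* (+ 2) (+ n)) ⟩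
  ι (+ 2) ℚ.* ι (+ n) ℚ.+ ι (+ m) ℚ.+ 1ℚ
    ≤⟨ ℚ.+-monoˡ-≤ 1ℚ (ℚ.+-mono-≤ (ℚ.*-monoˡ-≤-nonNeg (ι (+ 2)) n≤) m≤) ⟩
  ι (+ 2) ℚ.* Δ₁ ℚ.+ Δ₂ ℚ.+ 1ℚ                    ∎
  where
  open ℚ.≤-Reasoning
  arrange : ∀ m n → m ℤ.+ (n ℤ.+ (n ℤ.+ + 0) ℤ.+ + 1) ≡ + 2 ℤ.* n ℤ.+ m ℤ.+ + 1
  arrange = solve-∀

-- A region comes with a tiling, whose normalised height function extends `f`; hence the uniform
-- distribution is taken over a nonempty list.
extension : ∀ {R f} → Mandated R f → ∃ (Extends R f)
extension {R} mandated =
  let T , tiling = tileable R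
      h , heightOf , agrees = mandated T tiling
  in h , record { isHeight = IsHeightOf.isHeight heightOf ; agrees = agrees }

module _ {R₁ R₂ : Region} {f₁ f₂ : Heights} {Δ₁ Δ₂ : ℚ}
  (near₁ : ∀ v₁ → OnBoundary R₁ v₁ → ∃ λ v₂ → OnBoundary R₂ v₂ × + supDist v₁ v₂ / 1 ℚ.≤ Δ₁)
  (near₂ : ∀ v₂ → OnBoundary R₂ v₂ → ∃ λ v₁ → OnBoundary R₁ v₁ × + supDist v₂ v₁ / 1 ℚ.≤ Δ₁)
  (close : ∀ v₁ v₂ → OnBoundary R₁ v₁ → OnBoundary R₂ v₂ → + supDist v₁ v₂ / 1 ℚ.≤ Δ₁ →
    + ℤ.∣ f₁ v₁ ℤ.- f₂ v₂ ∣ / 1 ℚ.≤ Δ₂)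
  where

  C : ℚ
  C = + 2 / 1 ℚ.* Δ₁ ℚ.+ Δ₂ ℚ.+ 1ℚ

  module _ {a b : Heights} (A : Extends R₁ f₁ a) (B : Extends R₂ f₂ b) where

    -- A walk in `R₂` from `w` towards `t` ends at a boundary vertex `x` of `R₂` with
    -- `b x ≤ b w + 2 * n + 1`. It stays within distance `n` of `w`, so `close` compares `f₁ w` with
    -- `f₂ x`.
    boundary-gap₁ : ∀ w → OnBoundary R₁ w → IsVertex R₂ w → ι (a w ℤ.- b w) ℚ.≤ C
    boundary-gap₁ w bw w∈₂ =
      let t , bt , wt≤ = near₁ w bw
          n = supDist w t
          x , bx , wx≤ , bx≤ = near-boundary (height-climb (Extends.isHeight B)) n w t
            (λ c → dist≤supDist c w t) w∈₂ bt
      in combined-bound {a w ℤ.- b w} {∣ f₁ w ℤ.- f₂ x ∣} {n} (gap x n bx bx≤)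
           (close w x bw bx (ℚ.≤-trans (ι-mono-≤ (ℤ.+≤+ wx≤)) wt≤)) wt≤
      where
      open ℤ.≤-Reasoning
      identity : ∀ p q x m → p ℤ.- q ℤ.+ (q ℤ.+ m) ≡ p ℤ.- x ℤ.+ m ℤ.+ x
      identity = solve-∀
      gap : ∀ x n → OnBoundary R₂ x → b x ℤ.≤ b w ℤ.+ + (2 ℕ.* n ℕ.+ 1) →
            a w ℤ.- b w ℤ.≤ + ∣ f₁ w ℤ.- f₂ x ∣ ℤ.+ + (2 ℕ.* n ℕ.+ 1)
      gap x n bx bx≤ = begin
        a w ℤ.- b w                     ≤⟨ ≤-shift bx≤ (identity (a w) (b w) (b x) m) ⟩
        a w ℤ.- b x ℤ.+ m               ≡⟨ cong₂ (λ i j → i ℤ.- j ℤ.+ m)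
                                             (Extends.agrees A w bw) (Extends.agrees B x bx) ⟩
        f₁ w ℤ.- f₂ x ℤ.+ m             ≤⟨ ℤ.+-monoˡ-≤ m (i≤∣i∣ (f₁ w ℤ.- f₂ x)) ⟩
        + ∣ f₁ w ℤ.- f₂ x ∣ ℤ.+ m       ∎
        where
        m : ℤ
        m = + (2 ℕ.* n ℕ.+ 1)

    -- The walk now takes place in `R₁` and controls the descent of `a`, that is, the climb of
    -- `- a`.
    boundary-gap₂ : ∀ w → IsVertex R₁ w → OnBoundary R₂ w → ι (a w ℤ.- b w) ℚ.≤ C
    boundary-gap₂ w w∈₁ bw =
      let t , bt , wt≤ = near₂ w bw
          n = supDist w t
          x , bx , wx≤ , ax≤ = near-boundary (depth-climb (Extends.isHeight A)) n w t
            (λ c → dist≤supDist c w t) w∈₁ bt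
          xw≤ = subst (ℕ._≤ n) (supDist-sym w x) wx≤
      in combined-bound {a w ℤ.- b w} {∣ f₁ x ℤ.- f₂ w ∣} {n} (gap x n bx ax≤)
           (close x w bx bw (ℚ.≤-trans (ι-mono-≤ (ℤ.+≤+ xw≤)) wt≤)) wt≤
      where
      open ℤ.≤-Reasoning
      identity : ∀ p q x m → p ℤ.- q ℤ.+ (ℤ.- p ℤ.+ m) ≡ x ℤ.- q ℤ.+ m ℤ.+ ℤ.- x
      identity = solve-∀
      gap : ∀ x n → OnBoundary R₁ x → ℤ.- a x ℤ.≤ ℤ.- a w ℤ.+ + (2 ℕ.* n ℕ.+ 1) →
            a w ℤ.- b w ℤ.≤ + ∣ f₁ x ℤ.- f₂ w ∣ ℤ.+ + (2 ℕ.* n ℕ.+ 1)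
      gap x n bx ax≤ = begin
        a w ℤ.- b w                     ≤⟨ ≤-shift ax≤ (identity (a w) (b w) (a x) m) ⟩
        a x ℤ.- b w ℤ.+ m               ≡⟨ cong₂ (λ i j → i ℤ.- j ℤ.+ m)
                                             (Extends.agrees A x bx) (Extends.agrees B w bw) ⟩
        f₁ x ℤ.- f₂ w ℤ.+ m             ≤⟨ ℤ.+-monoˡ-≤ m (i≤∣i∣ (f₁ x ℤ.- f₂ w)) ⟩
        + ∣ f₁ x ℤ.- f₂ w ∣ ℤ.+ m       ∎
        where
        m : ℤ
        m = + (2 ℕ.* n ℕ.+ 1)

  𝔼-difference-≤ : Mandated R₁ f₁ → Mandated R₂ f₂ → AgreeMod4 R₁ R₂ f₁ f₂ →
    ∀ v → IsVertex R₁ v → IsVertex R₂ v →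
    𝔼 (μ R₁ f₁) (λ H → H v / 1) ℚ.- 𝔼 (μ R₂ f₂) (λ H → H v / 1) ℚ.≤ C
  𝔼-difference-≤ mandated₁ mandated₂ agree v v∈₁ v∈₂ = begin
    x ℚ.- y                ≤⟨ ℚ.+-monoˡ-≤ (ℚ.- y)
                                (𝔼-height-≤ (enumeration R₁ f₁) (enumeration R₂ f₂) D
                                  above⇒interior congruent
                                  (extension mandated₁) (extension mandated₂) v (v∈₁ , v∈₂)) ⟩
    (y ℚ.+ ι D) ℚ.- y      ≡⟨ cancel y (ι D) ⟩
    ι D                    ≤⟨ D≤C ⟩
    C                      ∎
    where
    open ℚ.≤-Reasoning
    x y : ℚ
    x = 𝔼 (μ R₁ f₁) (λ H → H v / 1)
    y = 𝔼 (μ R₂ f₂) (λ H → H v / 1)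

    largest = multiple-below 4 C
    k D : ℤ
    k = proj₁ largest
    -- With `D` a multiple of 4, the difference `a - (b + D)` remains one; and a boundary gap, being
    -- a multiple of 4 at most `C`, is at most `D`.
    D = + 4 ℤ.* k

    D≤C : ι D ℚ.≤ C
    D≤C = proj₁ (proj₂ largest)

    cancel : ∀ y d → (y ℚ.+ d) ℚ.- y ≡ d
    cancel = solve 2 (λ y d → (y :+ d) :- y := d) refl

    multiple≤D : ∀ {z} → + 4 ∣ z → ι z ℚ.≤ C → z ℤ.≤ D
    multiple≤D {z} 4∣z z≤C with Signed.∣ᵤ⇒∣ {+ 4} {z} 4∣z
    ... | Signed.divides q refl = subst (ℤ._≤ D) (ℤ.*-comm (+ 4) q) (ℤ.*-monoˡ-≤-nonNeg (+ 4)
          (proj₂ (proj₂ largest) q (subst (λ i → ι i ℚ.≤ C) (ℤ.*-comm q (+ 4)) z≤C)))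

    congruent : ∀ a b → Extends R₁ f₁ a → Extends R₂ f₂ b → ∀ w → Common R₁ R₂ w →
      + 4 ∣ a w ℤ.- (b w ℤ.+ D)
    congruent a b A B w (w∈₁ , w∈₂) = Signed.∣⇒∣ᵤ (subst (Signed._∣_ (+ 4)) (regroup (a w) (b w) D)
      (Signed.∣m∣n⇒∣m-n (Signed.∣ᵤ⇒∣ {+ 4} {a w ℤ.- b w} (agree a b A B w w∈₁ w∈₂))
                        (Signed.∣m⇒∣m*n k Signed.∣-refl)))
      where
      regroup : ∀ a b D → a ℤ.- b ℤ.- D ≡ a ℤ.- (b ℤ.+ D)
      regroup = solve-∀

    above⇒interior : ∀ a b → Extends R₁ f₁ a → Extends R₂ f₂ b →
      ∀ w → Common R₁ R₂ w → b w ℤ.+ D ℤ.< a w → ¬ OnBoundary R₁ w × ¬ OnBoundary R₂ w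
    above⇒interior a b A B w (w∈₁ , w∈₂) b+D<a =
        (λ bw → contradict (boundary-gap₁ A B w bw w∈₂))
      , (λ bw → contradict (boundary-gap₂ A B w w∈₁ bw))
      where
      contradict : ¬ ι (a w ℤ.- b w) ℚ.≤ C
      contradict gap = ℤ.<⇒≱ b+D<a
        (≤-shift (multiple≤D (agree a b A B w w∈₁ w∈₂) gap) (identity (a w) (b w) D))
        where
        identity : ∀ a b D → a ℤ.+ D ≡ b ℤ.+ D ℤ.+ (a ℤ.- b)
        identity = solve-∀

agreeMod4-sym : ∀ {R₁ R₂ f₁ f₂} → AgreeMod4 R₁ R₂ f₁ f₂ → AgreeMod4 R₂ R₁ f₂ f₁
agreeMod4-sym agree h₂ h₁ H₂ H₁ v v∈₂ v∈₁ =
  subst (4 ℕ.∣_) (ℤ.∣i-j∣≡∣j-i∣ (h₁ v) (h₂ v)) (agree h₁ h₂ H₁ H₂ v v∈₁ v∈₂)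

proposition20 : (R₁ R₂ : Region) → SimplyConnected R₁ → SimplyConnected R₂ →
    (f₁ f₂ : Heights) → Mandated R₁ f₁ → Mandated R₂ f₂ →
    AgreeMod4 R₁ R₂ f₁ f₂ →
    (Δ₁ Δ₂ : ℚ) →
    (∀ v₁ → OnBoundary R₁ v₁ → ∃ λ v₂ → OnBoundary R₂ v₂ × + supDist v₁ v₂ / 1 ℚ.≤ Δ₁) →
    (∀ v₂ → OnBoundary R₂ v₂ → ∃ λ v₁ → OnBoundary R₁ v₁ × + supDist v₂ v₁ / 1 ℚ.≤ Δ₁) →
    (∀ v₁ v₂ → OnBoundary R₁ v₁ → OnBoundary R₂ v₂ → + supDist v₁ v₂ / 1 ℚ.≤ Δ₁ →
    + ℤ.∣ f₁ v₁ ℤ.- f₂ v₂ ∣ / 1 ℚ.≤ Δ₂) →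
    ∀ v → IsVertex R₁ v → IsVertex R₂ v →
    ℚ.∣ 𝔼 (μ R₁ f₁) (λ H → H v / 1) ℚ.- 𝔼 (μ R₂ f₂) (λ H → H v / 1) ∣
    ℚ.≤ + 2 / 1 ℚ.* Δ₁ ℚ.+ Δ₂ ℚ.+ 1ℚ
proposition20 R₁ R₂ _ _ f₁ f₂ mandated₁ mandated₂ agree Δ₁ Δ₂ near₁ near₂ close v v∈₁ v∈₂ =
  -- The two signs of the difference are covered by the one-sided estimate for the regions in either
  -- order.
  [ (λ eq → subst (ℚ._≤ _) (sym eq) forward)
  , (λ eq → subst (ℚ._≤ _) (sym (trans eq (neg-minus x y))) backward)
  ]′ (ℚ.∣p∣≡p∨∣p∣≡-p (x ℚ.- y))
  where
  x y : ℚ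
  x = 𝔼 (μ R₁ f₁) (λ H → H v / 1)
  y = 𝔼 (μ R₂ f₂) (λ H → H v / 1)

  neg-minus : ∀ x y → ℚ.- (x ℚ.- y) ≡ y ℚ.- x
  neg-minus = solve 2 (λ x y → :- (x :- y) := y :- x) refl

  forward : x ℚ.- y ℚ.≤ + 2 / 1 ℚ.* Δ₁ ℚ.+ Δ₂ ℚ.+ 1ℚ
  forward = 𝔼-difference-≤ near₁ near₂ close mandated₁ mandated₂ agree v v∈₁ v∈₂

  backward : y ℚ.- x ℚ.≤ + 2 / 1 ℚ.* Δ₁ ℚ.+ Δ₂ ℚ.+ 1ℚ
  backward = 𝔼-difference-≤ near₂ near₁ close′ mandated₂ mandated₁
      (agreeMod4-sym {R₁} {R₂} {f₁} {f₂} agree) v v∈₂ v∈₁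
    where
    close′ : ∀ v₂ v₁ → OnBoundary R₂ v₂ → OnBoundary R₁ v₁ → + supDist v₂ v₁ / 1 ℚ.≤ Δ₁ →
             + ∣ f₂ v₂ ℤ.- f₁ v₁ ∣ / 1 ℚ.≤ Δ₂
    close′ v₂ v₁ b₂ b₁ d≤ = subst (λ n → + n / 1 ℚ.≤ Δ₂) (ℤ.∣i-j∣≡∣j-i∣ (f₁ v₁) (f₂ v₂))
      (close v₁ v₂ b₁ b₂ (subst (λ n → + n / 1 ℚ.≤ Δ₁) (supDist-sym v₂ v₁) d≤))
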